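{- Let $\varepsilon>0$, let $D>0$, and let $i,j\ge 2$ be integers. Put $C_{i,j}=\log 2\,\big(\frac1i+\frac1j\big)$ and $$h(x)=\exp\Big((C_{i,j}+2\varepsilon)\frac{\log x}{\log\log x}\Big).$$ Then there exist constants $E,N>0$, depending only on $\varepsilon$ and $D$, such that for every real $x>N$, $$\sum_{x<n\le x+h(x)}\exp(-D\,d_{i,j}(n))\ \ge\ E\exp\Big((C_{i,j}+\varepsilon)\frac{\log x}{\log\log x}\Big).$$
   Context: $\mathbb{N}$ denotes the positive integers and $\log$ is the natural logarithm. For $i,j,n\in\mathbb{N}$, $d_{i,j}(n)$ is the number of pairs $(a,b)\in\mathbb{N}^2$ with $a^i b^j\mid n$. The sum runs over integers $n$ in the interval $(x,x+h(x)]$. -}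

module Defs where

open import Level using (0ℓ)
open import Algebra.Bundles using (CommutativeRing)
open import Algebra.Structures using (IsCommutativeRing)
open import Axiom.ExcludedMiddle using (ExcludedMiddle)
open import Data.List.Base using (List; map; foldr; filter; length; upTo; cartesianProduct)
open import Data.Nat.Base as ℕ using (ℕ; suc; _!)
open import Data.Nat.Divisibility using (_∣?_)
open import Data.Product.Base using (∃; _×_; _,_)
open import Relation.Binary.Core using (Rel)
open import Relation.Binary.Structures using (IsTotalOrder)
open import Relation.Nullary using (¬_; yes; no)
open import Relation.Nullary.Decidable using (_×-dec_)
import Algebra.Properties.Monoid.Mult as MonoidMult
import Algebra.Properties.Semiring.Exp as SemiringExp
import Relation.Binary.Construct.NonStrictToStrict as NonStrictToStrict

-- The number of pairs (a , b) of positive integers with aⁱ bʲ ∣ n.  For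
-- i, j, n ≥ 1 such a and b divide n, so searching 1 , … , n is exhaustive.
d : ℕ → ℕ → ℕ → ℕ
d i j n = length (filter (λ (a , b) → (a ℕ.^ i ℕ.* b ℕ.^ j) ∣? n)
                         (cartesianProduct [1⋯n] [1⋯n]))
  where
  [1⋯n] : List ℕ
  [1⋯n] = map suc (upTo n)

-- The real numbers, specified up to unique isomorphism as a
-- (Dedekind-)complete ordered field.  Equality is a setoid equality so that
-- Cauchy or Dedekind reals qualify without quotients; given excluded middle,
-- they satisfy all the fields.
record CompleteOrderedField : Set₁ where
  infix  8 _⁻¹
  infix  8 -_
  infixl 7 _*_
  infixl 6 _+_
  infix  4 _≈_ _≤_ _<_
  field
    Carrier           : Set
    _≈_ _≤_           : Rel Carrier 0ℓ
    _+_ _*_           : Carrier → Carrier → Carrier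
    -_ _⁻¹            : Carrier → Carrier
    0# 1#             : Carrier
    isCommutativeRing : IsCommutativeRing _≈_ _+_ _*_ -_ 0# 1#
    0≉1               : ¬ (0# ≈ 1#)
    -- The value of 0# ⁻¹ is left unspecified.
    ⁻¹-cong           : ∀ {x y} → x ≈ y → x ⁻¹ ≈ y ⁻¹
    *-inverseʳ        : ∀ x → ¬ (x ≈ 0#) → x * x ⁻¹ ≈ 1#
    isTotalOrder      : IsTotalOrder _≈_ _≤_
    +-monoˡ-≤         : ∀ z {x y} → x ≤ y → x + z ≤ y + z
    *-nonNeg          : ∀ {x y} → 0# ≤ x → 0# ≤ y → 0# ≤ x * y

  UpperBound : (Carrier → Set) → Carrier → Set
  UpperBound P u = ∀ x → P x → x ≤ u

  field
    complete : (P : Carrier → Set) → ∃ P → ∃ (UpperBound P) →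
               ∃ λ s → UpperBound P s × (∀ u → UpperBound P u → s ≤ u)

  _<_ : Rel Carrier 0ℓ
  _<_ = NonStrictToStrict._<_ _≈_ _≤_

  commutativeRing : CommutativeRing 0ℓ 0ℓ
  commutativeRing = record { isCommutativeRing = isCommutativeRing }

module Analysis (em : ExcludedMiddle 0ℓ) (R : CompleteOrderedField) where

  open CompleteOrderedField R public renaming (Carrier to ℝ)
  open CommutativeRing commutativeRing public using (_-_)
  open SemiringExp (CommutativeRing.semiring commutativeRing) public using (_^_)

  infixl 7 _/_
  _/_ : ℝ → ℝ → ℝ
  x / y = x * y ⁻¹

  fromℕ : ℕ → ℝ
  fromℕ n = MonoidMult._×_ (CommutativeRing.+-monoid commutativeRing) n 1#

  ∑ : List ℕ → (ℕ → ℝ) → ℝ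
  ∑ ns f = foldr _+_ 0# (map f ns)

  infix 4 _⟶_
  _⟶_ : (ℕ → ℝ) → ℝ → Set
  s ⟶ l = ∀ δ → 0# < δ → ∃ λ M → ∀ n → M ℕ.≤ n → l - δ < s n × s n < l + δ

  -- Definite description: some element satisfying P, or the given default if
  -- there is none.  Below it is only applied to predicates satisfied by at
  -- most one element (up to _≈_).
  the : {A : Set} → A → (A → Set) → A
  the default P with em {∃ P}
  ... | yes (a , _) = a
  ... | no _        = default

  exp : ℝ → ℝ
  exp x = the 0# (λ l → (λ m → ∑ (upTo m) (λ k → x ^ k / fromℕ (k !))) ⟶ l)

  -- The natural logarithm on the positive reals, and 0 elsewhere.
  log : ℝ → ℝ
  log y = the 0# (λ x → exp x ≈ y)

  -- ⌊ y ⌋ for y ≥ 0, and 0 for y < 0.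
  floor : ℝ → ℕ
  floor y = the 0 (λ m → fromℕ m ≤ y × y < fromℕ (suc m))

  -- The natural numbers n with x < n ≤ y, which for x ≥ 0 are all the
  -- integers in (x , y].
  integersIn⦅_,_] : ℝ → ℝ → List ℕ
  integersIn⦅ x , y ] = filter (λ n → em {x < fromℕ n} ×-dec em {fromℕ n ≤ y})
                              (upTo (suc (floor y)))

  C : ℕ → ℕ → ℝ
  C i j = log (fromℕ 2) * (1# / fromℕ i + 1# / fromℕ j)

  h : ℝ → ℕ → ℕ → ℝ → ℝ
  h ε i j x = exp ((C i j + fromℕ 2 * ε) * (log x / log (log x)))

-- Write H for the number of integers in (x , x + h(x)].  As 1/2² + 1/3² + … ≤ 3/4,
-- at least H/8 of them are divisible by no a² with 2 ≤ a ≤ H/8.  For such an n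
-- and i ≥ 2, every a > 1 with aⁱ ∣ n is larger than h/8, so stripping prime powers
-- pⁱ off n ends after at most log n / (i log (h/8)) steps, each of which at most halves the
-- number of these a.  Therefore d i j n ≤ exp (C i j · log n / log (h/8)), which is
-- (log x)^(C/(C + 2ε) + o(1)) and hence at most (ε/D) log x / log log x for large x,
-- uniformly in i and j because C i j ≤ 1.  Each of the H/8 integers thus contributes
-- at least exp (− ε log x / log log x) to the sum.

module Submission where

open import Defs
open import Level using (0ℓ)
open import Axiom.ExcludedMiddle using (ExcludedMiddle)
open import Data.Nat.Base as ℕ using (ℕ)
open import Data.Product.Base using (∃; _×_)

-- Sieving by squares is enough because `i ≥ 2` makes `a * a` divide `a ^ i`. The survivors
-- therefore do not depend on `i` and `j`, and neither do `E` and `N`. Each square may hit one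
-- integer more than its density predicts, so stopping at H/8 costs at most H/8 on top of 3H/4,
-- which leaves H/8.
--
-- Of the exponent `2ε` in `h`, one `ε` is surrendered to the penalty `exp (- (D * d))` and the
-- other survives in the conclusion. The same `2ε` pushes `d` below log x: as C ≤ 1, the exponent
-- C/(C + 2ε) is at most 1 - 2δ with δ = ε/(1 + 2ε). One δ absorbs the lower order terms, the other
-- beats the factor D log log x / ε. All of this is done by explicit inequalities resting on x² ≤ 4
-- exp x.
--
-- Since `exp` and `log` are given only by definite descriptions, the law exp (x + y) = exp x · exp
-- y and the existence of logarithms must first be derived from the series and from completeness.

module Arithmetic where

  open import Data.List.Base using (List; []; _∷_; [_]; _++_; map; filter; length; upTo; cartesianProduct)
  open import Data.List.Membership.Propositional using (_∈_)
  open import Data.List.Membership.Propositional.Properties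
    using (∈-∃++; ∈-++⁺ˡ; ∈-++⁺ʳ; ∈-++⁻; ∈-map⁺; ∈-filter⁻; ∈-cartesianProduct⁺)
  open import Data.List.Properties using (length-++; length-map; upTo-∷ʳ; filter-++)
  open import Data.List.Relation.Unary.All as All using ()
  open import Data.List.Relation.Unary.AllPairs.Core using (_∷_)
  open import Data.List.Relation.Unary.Any using (here; there)
  open import Data.List.Relation.Unary.Unique.Propositional using (Unique)
  import Data.List.Relation.Unary.Unique.Propositional.Properties as Unique
  open import Data.Nat.Base
  open import Data.Nat.Coprimality using (Coprime; coprime-divisor)
  open import Data.Nat.Divisibility
  open import Data.Nat.DivMod using (_/_; _%_; m≡m%n+[m/n]*n; m%n<n)
  open import Data.Nat.Induction using (<-rec)
  open import Data.Nat.ListAction using (product)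
  open import Data.Nat.Primality using (Prime; euclidsLemma; prime⇒irreducible; prime⇒nonZero; prime⇒nonTrivial; ¬prime[1])
  open import Data.Nat.Primality.Factorisation using (factorise)
  open import Data.Nat.Properties
  open import Data.Nat.Tactic.RingSolver using (solve-∀)
  open import Data.Product.Base using (_,_; proj₁; proj₂)
  open import Data.Sum.Base using (_⊎_; inj₁; inj₂)
  open import Function.Base using (_∘_)
  open import Relation.Binary.PropositionalEquality.Core using (_≡_; refl; sym; trans; cong; cong₂; subst)
  open import Relation.Nullary using (¬_; yes; no; contradiction; ¬?)
  open import Relation.Nullary.Decidable using (_×-dec_)
  open import Relation.Unary using (Decidable)

  open ≤-Reasoning

  -- Lengths of duplicate-free lists

  unique-⊆⇒length≤ : ∀ {A : Set} {xs ys : List A} → Unique xs → (∀ {x} → x ∈ xs → x ∈ ys) → length xs ≤ length ys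
  unique-⊆⇒length≤ {xs = []} _ _ = z≤n
  unique-⊆⇒length≤ {xs = x ∷ xs} (x∉xs ∷ unique) ⊆ys with ∈-∃++ (⊆ys (here refl))
  ... | ys₁ , ys₂ , refl = begin
    suc (length xs)               ≤⟨ s≤s (unique-⊆⇒length≤ unique remaining) ⟩
    suc (length (ys₁ ++ ys₂))     ≡⟨ cong suc (length-++ ys₁) ⟩
    suc (length ys₁ + length ys₂) ≡⟨ +-suc (length ys₁) (length ys₂) ⟨
    length ys₁ + suc (length ys₂) ≡⟨ length-++ ys₁ ⟨
    length (ys₁ ++ x ∷ ys₂)       ∎
    where
    remaining : ∀ {y} → y ∈ xs → y ∈ ys₁ ++ ys₂
    remaining y∈xs with ∈-++⁻ ys₁ (⊆ys (there y∈xs))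
    ... | inj₁ y∈ys₁         = ∈-++⁺ˡ y∈ys₁
    ... | inj₂ (here refl)   = contradiction refl (All.lookup x∉xs y∈xs)
    ... | inj₂ (there y∈ys₂) = ∈-++⁺ʳ ys₁ y∈ys₂

  length-cartesianProduct : ∀ {A B : Set} (xs : List A) (ys : List B) → length (cartesianProduct xs ys) ≡ length xs * length ys
  length-cartesianProduct []       ys = refl
  length-cartesianProduct (x ∷ xs) ys = trans (length-++ (map (x ,_) ys))
    (cong₂ _+_ (length-map (x ,_) ys) (length-cartesianProduct xs ys))

  -- Roots of power divisors

  ∃-prime-divisor : ∀ {n} → 1 < n → ∃ λ p → Prime p × p ∣ n
  ∃-prime-divisor {n@(suc _)} 1<n with factorise n
  ... | record { factors = []     ; isFactorisation = n≡1 } = contradiction n≡1 (>⇒≢ 1<n)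
  ... | record { factors = p ∷ ps ; isFactorisation = n≡pps ; factorsPrime = p-prime All.∷ _ } =
    p , p-prime , divides (product ps) (trans n≡pps (*-comm p (product ps)))

  prime∣^⇒prime∣ : ∀ {p} → Prime p → ∀ a i → p ∣ a ^ i → p ∣ a
  prime∣^⇒prime∣ p-prime a zero p∣1 = contradiction (subst Prime (∣1⇒≡1 p∣1) p-prime) ¬prime[1]
  prime∣^⇒prime∣ p-prime a (suc i) p∣a^1+i with euclidsLemma a (a ^ i) p-prime p∣a^1+i
  ... | inj₁ p∣a   = p∣a
  ... | inj₂ p∣a^i = prime∣^⇒prime∣ p-prime a i p∣a^i

  -- A common divisor of `a ^ i` and the prime `p` is 1 or `p`, and `p` would divide `a`. By
  -- coprimality the factors `p` cancel one at a time.
  ^∣prime^*⇒^∣ : ∀ {p a} → Prime p → p ∤ a → ∀ i j {n} → a ^ i ∣ p ^ j * n → a ^ i ∣ n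
  ^∣prime^*⇒^∣ p-prime p∤a i zero {n} a^i∣ = subst (_ ∣_) (*-identityˡ n) a^i∣
  ^∣prime^*⇒^∣ {p} {a} p-prime p∤a i (suc j) {n} a^i∣ =
    ^∣prime^*⇒^∣ p-prime p∤a i j (coprime-divisor coprime (subst (a ^ i ∣_) (*-assoc p (p ^ j) n) a^i∣))
    where
    coprime : Coprime (a ^ i) p
    coprime (c∣a^i , c∣p) with prime⇒irreducible p-prime c∣p
    ... | inj₁ c≡1  = c≡1
    ... | inj₂ refl = contradiction (prime∣^⇒prime∣ p-prime a i c∣a^i) p∤a

  ^-monoˡ-∣ : ∀ {m n} k → m ∣ n → m ^ k ∣ n ^ k
  ^-monoˡ-∣ zero    m∣n = ∣-refl
  ^-monoˡ-∣ (suc k) m∣n = *-pres-∣ m∣n (^-monoˡ-∣ k m∣n)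

  ^-distribʳ-* : ∀ m n k → (m * n) ^ k ≡ m ^ k * n ^ k
  ^-distribʳ-* m n zero    = refl
  ^-distribʳ-* m n (suc k) = trans (cong (m * n *_) (^-distribʳ-* m n k)) (regroup m n (m ^ k) (n ^ k))
    where
    regroup : ∀ m n x y → m * n * (x * y) ≡ m * x * (n * y)
    regroup = solve-∀

  -- Stripping a prime power p ^ i off n at most doubles the set of a with
  -- a ^ i ∣ n: such an a either is prime to p or is p times one for n / p ^ i.
  power-divisors : ∀ w i .{{_ : NonZero i}} n .{{_ : NonZero n}} →
    (∀ a → 1 < a → a ^ i ∣ n → w ≤ a) →
    ∃ λ k → w ^ (i * k) ≤ n × ∃ λ as → length as ≤ 2 ^ k × (∀ a → a ^ i ∣ n → a ∈ as)
  power-divisors w i@(suc i-1) n {{n≢0}} = <-rec Claim step n n≢0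
    where
    Claim : ℕ → Set
    Claim n = .(NonZero n) → (∀ a → 1 < a → a ^ i ∣ n → w ≤ a) →
      ∃ λ k → w ^ (i * k) ≤ n × ∃ λ as → length as ≤ 2 ^ k × (∀ a → a ^ i ∣ n → a ∈ as)

    step : ∀ n → (∀ {m} → m < n → Claim m) → Claim n
    -- A root satisfies `a ≤ a ^ i ≤ n`, so the bounded search is exhaustive. If it fails, only the
    -- root 1 is left, since `n ≠ 0` rules out 0.
    step n rec n≢0 rough with anyUpTo? (λ a → (1 <? a) ×-dec (a ^ i ∣? n)) (suc n)
    ... | no ∄a = 0 , subst (λ k → w ^ k ≤ n) (sym (*-zeroʳ i)) (>-nonZero⁻¹ n {{n≢0}}) , [ 1 ] , ≤-refl , trivial
      where
      trivial : ∀ a → a ^ i ∣ n → a ∈ [ 1 ]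
      trivial zero          0∣n   = contradiction (0∣⇒≡0 0∣n) (≢-nonZero⁻¹ n {{n≢0}})
      trivial (suc zero)    _     = here refl
      trivial a@(suc (suc _)) a^i∣n = contradiction
        (a , s≤s (∣⇒≤ {{n≢0}} (∣-trans (m∣m*n (a ^ i-1)) a^i∣n)) , s≤s (s≤s z≤n) , a^i∣n) ∄a
    ... | yes (a , _ , 1<a , a^i∣n) with ∃-prime-divisor 1<a
    ... | p , p-prime , p∣a = extend (∣-trans (^-monoˡ-∣ i p∣a) a^i∣n)
      where
      instance
        _ = prime⇒nonZero p-prime
        _ = prime⇒nonTrivial p-prime
        _ = m^n≢0 p i
      extend : p ^ i ∣ n → ∃ λ k → w ^ (i * k) ≤ n × ∃ λ as → length as ≤ 2 ^ k × (∀ a → a ^ i ∣ n → a ∈ as)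
      -- Roughness passes to the cofactor `m` because `m` divides `n`.
      extend p^i∣n@(divides m n≡mp^i) with rec m<n m≢0 (λ a 1<a a^i∣m → rough a 1<a (∣-trans a^i∣m m∣n))
        where
        1<p : 1 < p
        1<p = nonTrivial⇒n>1 p
        m≢0 : NonZero m
        m≢0 = quotient≢0 p^i∣n {{n≢0}}
        m<n : m < n
        m<n = quotient-< p^i∣n {{n>1⇒nonTrivial (<-≤-trans 1<p (m≤m*n p (p ^ i-1) {{m^n≢0 p i-1}}))}} {{n≢0}}
        m∣n : m ∣ n
        m∣n = quotient-∣ p^i∣n
      ... | k , w^ik≤m , as , length≤ , complete = suc k , w^i[1+k]≤n , as ++ map (p *_) as , length-bound , complete′
        where
        n≡p^im : n ≡ p ^ i * m
        n≡p^im = trans n≡mp^i (*-comm m (p ^ i))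

        -- The prime `p` is itself a root above 1, so `w ≤ p`: every strip uses up a factor of at
        -- least `w ^ i` of `n`.
        w^i[1+k]≤n : w ^ (i * suc k) ≤ n
        w^i[1+k]≤n = begin
          w ^ (i * suc k)         ≡⟨ cong (w ^_) (*-suc i k) ⟩
          w ^ (i + i * k)         ≡⟨ ^-distribˡ-+-* w i (i * k) ⟩
          w ^ i * w ^ (i * k)     ≤⟨ *-mono-≤ (^-monoˡ-≤ i (rough p (nonTrivial⇒n>1 p) (divides m n≡mp^i))) w^ik≤m ⟩
          p ^ i * m               ≡⟨ n≡p^im ⟨
          n                       ∎

        length-bound : length (as ++ map (p *_) as) ≤ 2 ^ suc k
        length-bound = begin
          length (as ++ map (p *_) as)          ≡⟨ length-++ as ⟩
          length as + length (map (p *_) as)    ≡⟨ cong (length as +_) (length-map (p *_) as) ⟩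
          length as + length as                 ≤⟨ +-mono-≤ length≤ length≤ ⟩
          2 ^ k + 2 ^ k                         ≡⟨ cong (2 ^ k +_) (+-identityʳ (2 ^ k)) ⟨
          2 ^ suc k                             ∎

        complete′ : ∀ a → a ^ i ∣ n → a ∈ as ++ map (p *_) as
        complete′ a a^i∣n with p ∣? a
        ... | no  p∤a = ∈-++⁺ˡ (complete a (^∣prime^*⇒^∣ p-prime p∤a i i (subst (a ^ i ∣_) n≡p^im a^i∣n)))
        ... | yes (divides b refl) = ∈-++⁺ʳ as (subst (_∈ map (p *_) as) (*-comm p b) (∈-map⁺ (p *_) (complete b
          (*-cancelˡ-∣ (p ^ i) (subst (_∣ p ^ i * m) (trans (cong (_^ i) (*-comm b p)) (^-distribʳ-* p b i)) (subst ((b * p) ^ i ∣_) n≡p^im a^i∣n))))))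

  -- Weakening `a ^ i * b ^ j ∣ n` to separate conditions on `a` and `b` places the pairs in a
  -- product set. The product of the two covers is what produces the sum 1/i + 1/j of `C i j`.
  d-bound : ∀ i j n {as bs} → (∀ a → a ^ i ∣ n → a ∈ as) → (∀ b → b ^ j ∣ n → b ∈ bs) →
    d i j n ≤ length as * length bs
  d-bound i j n {as} {bs} as-complete bs-complete = begin
    d i j n                             ≤⟨ unique-⊆⇒length≤ (Unique.filter⁺ divides? (Unique.cartesianProduct⁺ unique unique)) covered ⟩
    length (cartesianProduct as bs)     ≡⟨ length-cartesianProduct as bs ⟩
    length as * length bs               ∎
    where
    divides? : Decidable (λ (a , b) → a ^ i * b ^ j ∣ n)
    divides? (a , b) = a ^ i * b ^ j ∣? n

    unique : Unique (map suc (upTo n))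
    unique = Unique.map⁺ suc-injective (Unique.upTo⁺ n)

    covered : ∀ {ab} → ab ∈ filter divides? (cartesianProduct (map suc (upTo n)) (map suc (upTo n))) →
              ab ∈ cartesianProduct as bs
    covered {a , b} ab∈ with ∈-filter⁻ divides? {xs = cartesianProduct (map suc (upTo n)) (map suc (upTo n))} ab∈
    ... | _ , a^ib^j∣n = ∈-cartesianProduct⁺ (as-complete a (m*n∣⇒m∣ (a ^ i) (b ^ j) a^ib^j∣n))
                                             (bs-complete b (m*n∣⇒n∣ (a ^ i) (b ^ j) a^ib^j∣n))

  -- Counting in an interval

  count : ∀ {P : ℕ → Set} → Decidable P → ℕ → ℕ
  count P? m = length (filter P? (upTo m))

  module _ {P : ℕ → Set} (P? : Decidable P) where

    private
      count-last : ∀ m → count P? (suc m) ≡ count P? m + length (filter P? [ m ])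
      count-last m = begin-equality
        length (filter P? (upTo (suc m)))                 ≡⟨ cong (length ∘ filter P?) (upTo-∷ʳ m) ⟨
        length (filter P? (upTo m ++ [ m ]))              ≡⟨ cong length (filter-++ P? (upTo m) [ m ]) ⟩
        length (filter P? (upTo m) ++ filter P? [ m ])    ≡⟨ length-++ (filter P? (upTo m)) ⟩
        count P? m + length (filter P? [ m ])             ∎

    count-accept : ∀ {m} → P m → count P? (suc m) ≡ suc (count P? m)
    count-accept {m} Pm with P? m | count-last m
    ... | yes _  | eq = trans eq (+-comm _ 1)
    ... | no ¬Pm | _  = contradiction Pm ¬Pm

    count-reject : ∀ {m} → ¬ P m → count P? (suc m) ≡ count P? m
    count-reject {m} ¬Pm with P? m | count-last m
    ... | yes Pm | _  = contradiction Pm ¬Pm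
    ... | no _   | eq = trans eq (+-identityʳ _)

    count-suc-≤ : ∀ m → count P? m ≤ count P? (suc m)
    count-suc-≤ m = ≤-trans (m≤m+n _ _) (≤-reflexive (sym (count-last m)))

  count-⊎ : ∀ {P Q R : ℕ → Set} (P? : Decidable P) (Q? : Decidable Q) (R? : Decidable R) →
    (∀ {n} → P n → Q n ⊎ R n) → ∀ m → count P? m ≤ count Q? m + count R? m
  count-⊎ P? Q? R? P⊆Q∪R zero = z≤n
  count-⊎ P? Q? R? P⊆Q∪R (suc m) with P? m
  ... | no ¬Pm = begin
    count P? (suc m)                       ≡⟨ count-reject P? ¬Pm ⟩
    count P? m                             ≤⟨ count-⊎ P? Q? R? P⊆Q∪R m ⟩
    count Q? m + count R? m                ≤⟨ +-mono-≤ (count-suc-≤ Q? m) (count-suc-≤ R? m) ⟩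
    count Q? (suc m) + count R? (suc m)    ∎
  ... | yes Pm with P⊆Q∪R Pm
  ...   | inj₁ Qm = begin
    count P? (suc m)                       ≡⟨ count-accept P? Pm ⟩
    suc (count P? m)                       ≤⟨ s≤s (count-⊎ P? Q? R? P⊆Q∪R m) ⟩
    suc (count Q? m) + count R? m          ≡⟨ cong (_+ count R? m) (count-accept Q? Qm) ⟨
    count Q? (suc m) + count R? m          ≤⟨ +-monoʳ-≤ (count Q? (suc m)) (count-suc-≤ R? m) ⟩
    count Q? (suc m) + count R? (suc m)    ∎
  ...   | inj₂ Rm = begin
    count P? (suc m)                       ≡⟨ count-accept P? Pm ⟩
    suc (count P? m)                       ≤⟨ s≤s (count-⊎ P? Q? R? P⊆Q∪R m) ⟩
    suc (count Q? m + count R? m)          ≡⟨ +-suc (count Q? m) (count R? m) ⟨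
    count Q? m + suc (count R? m)          ≡⟨ cong (count Q? m +_) (count-accept R? Rm) ⟨
    count Q? m + count R? (suc m)          ≤⟨ +-monoˡ-≤ (count R? (suc m)) (count-suc-≤ Q? m) ⟩
    count Q? (suc m) + count R? (suc m)    ∎

  count-> : ∀ X H → count (X <?_) (suc (X + H)) ≡ H
  count-> X zero = trans (cong (count (X <?_) ∘ suc) (+-identityʳ X)) (none (suc X) ≤-refl)
    where
    none : ∀ m → m ≤ suc X → count (X <?_) m ≡ 0
    none zero    _       = refl
    none (suc m) 1+m≤1+X = trans (count-reject (X <?_) (≤⇒≯ (s≤s⁻¹ 1+m≤1+X))) (none m (<⇒≤ 1+m≤1+X))
  count-> X (suc H) = begin-equality
    count (X <?_) (suc (X + suc H))     ≡⟨ cong (count (X <?_) ∘ suc) (+-suc X H) ⟩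
    count (X <?_) (suc (suc (X + H)))   ≡⟨ count-accept (X <?_) (s≤s (m≤m+n X H)) ⟩
    suc (count (X <?_) (suc (X + H)))   ≡⟨ cong suc (count-> X H) ⟩
    suc H                               ∎

  module _ {P : ℕ → Set} (P? : Decidable P) (X : ℕ) where

    private
      >∧P? : Decidable (λ n → X < n × P n)
      >∧P? n = (X <? n) ×-dec P? n

    count-split : ∀ H → count >∧P? (suc (X + H)) + count P? (suc X) ≡ count P? (suc (X + H))
    count-split zero = trans (cong (λ Z → count >∧P? (suc Z) + count P? (suc X)) (+-identityʳ X))
      (trans (cong (_+ count P? (suc X)) (none (suc X) ≤-refl)) (cong (count P? ∘ suc) (sym (+-identityʳ X))))
      where
      none : ∀ m → m ≤ suc X → count >∧P? m ≡ 0
      none zero    _       = refl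
      none (suc m) 1+m≤1+X = trans (count-reject >∧P? (≤⇒≯ (s≤s⁻¹ 1+m≤1+X) ∘ proj₁)) (none m (<⇒≤ 1+m≤1+X))
    count-split (suc H) rewrite +-suc X H with P? (suc (X + H))
    ... | yes Pn = begin-equality
      count >∧P? (2 + (X + H)) + count P? (suc X)     ≡⟨ cong (_+ count P? (suc X)) (count-accept >∧P? (s≤s (m≤m+n X H) , Pn)) ⟩
      suc (count >∧P? (suc (X + H)) + count P? (suc X)) ≡⟨ cong suc (count-split H) ⟩
      suc (count P? (suc (X + H)))                    ≡⟨ count-accept P? Pn ⟨
      count P? (2 + (X + H))                          ∎
    ... | no ¬Pn = begin-equality
      count >∧P? (2 + (X + H)) + count P? (suc X)     ≡⟨ cong (_+ count P? (suc X)) (count-reject >∧P? (¬Pn ∘ proj₂)) ⟩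
      count >∧P? (suc (X + H)) + count P? (suc X)     ≡⟨ count-split H ⟩
      count P? (suc (X + H))                          ≡⟨ count-reject P? ¬Pn ⟨
      count P? (2 + (X + H))                          ∎

  -- The multiples of q counted here include 0.
  count-multiples : ∀ q .{{_ : NonZero q}} M → ∃ λ r → r < q × M + q ≡ count (q ∣?_) (suc M) * q + r
  count-multiples q zero = 0 , >-nonZero⁻¹ q , sym (begin-equality
    count (q ∣?_) 1 * q + 0   ≡⟨ cong (λ c → c * q + 0) (count-accept (q ∣?_) (q ∣0)) ⟩
    1 * q + 0                 ≡⟨ regroup q ⟩
    q                         ∎)
    where
    regroup : ∀ q → 1 * q + 0 ≡ q
    regroup = solve-∀
  count-multiples q (suc M) with count-multiples q M | q ∣? suc M
  -- Here `r` is the residue of `M` modulo `q`; it wraps round to 0 exactly when a new multiple is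
  -- met.
  ... | r , r<q , M+q≡ | yes q∣1+M = 0 , >-nonZero⁻¹ q , (begin-equality
    suc (M + q)                      ≡⟨ cong suc M+q≡ ⟩
    suc (c * q + r)                  ≡⟨ +-suc (c * q) r ⟨
    c * q + suc r                    ≡⟨ cong (c * q +_) 1+r≡q ⟩
    c * q + q                        ≡⟨ regroup c q ⟩
    suc c * q + 0                    ≡⟨ cong (λ c → c * q + 0) (count-accept (q ∣?_) q∣1+M) ⟨
    count (q ∣?_) (2 + M) * q + 0    ∎)
    where
    c = count (q ∣?_) (suc M)
    regroup : ∀ c q → c * q + q ≡ suc c * q + 0
    regroup = solve-∀
    q∣1+r : q ∣ suc r
    q∣1+r = ∣m+n∣m⇒∣n (subst (q ∣_) (trans (cong suc M+q≡) (sym (+-suc (c * q) r))) (∣m∣n⇒∣m+n q∣1+M ∣-refl)) (n∣m*n c)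
    1+r≡q : suc r ≡ q
    1+r≡q = ≤-antisym r<q (∣⇒≤ q∣1+r)
  ... | r , r<q , M+q≡ | no q∤1+M = suc r , ≤∧≢⇒< r<q 1+r≢q , (begin-equality
    suc (M + q)                      ≡⟨ cong suc M+q≡ ⟩
    suc (c * q + r)                  ≡⟨ +-suc (c * q) r ⟨
    c * q + suc r                    ≡⟨ cong (λ c → c * q + suc r) (count-reject (q ∣?_) q∤1+M) ⟨
    count (q ∣?_) (2 + M) * q + suc r ∎)
    where
    c = count (q ∣?_) (suc M)
    1+r≢q : ¬ (suc r ≡ q)
    1+r≢q 1+r≡q = q∤1+M (∣m+n∣m⇒∣n (subst (q ∣_) (sym eq) (∣m∣n⇒∣m+n (n∣m*n c) ∣-refl)) ∣-refl)
      where
      eq : q + suc M ≡ c * q + q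
      eq = trans (+-suc q M) (trans (cong suc (trans (+-comm q M) M+q≡)) (trans (sym (+-suc (c * q) r)) (cong (c * q +_) 1+r≡q)))

  -- Two prefix counts are subtracted: the residue is bounded by `q` in the lower one and dropped in
  -- the upper one. The surplus `q` on the right is the one extra multiple that an interval can
  -- catch.
  count-multiples-interval : ∀ q .{{_ : NonZero q}} X H →
    count (λ n → (X <? n) ×-dec (q ∣? n)) (suc (X + H)) * q ≤ H + q
  count-multiples-interval q X H with count-multiples q X | count-multiples q (X + H)
  ... | r , r<q , X+q≡ | r′ , _ , X+H+q≡ = +-cancelʳ-≤ X (c * q) (H + q) (begin
    c * q + X           ≤⟨ +-monoʳ-≤ (c * q) X≤bq ⟩
    c * q + b * q       ≡⟨ *-distribʳ-+ q c b ⟨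
    (c + b) * q         ≡⟨ cong (_* q) (count-split (q ∣?_) X H) ⟩
    b′ * q              ≤⟨ m≤m+n (b′ * q) r′ ⟩
    b′ * q + r′         ≡⟨ X+H+q≡ ⟨
    X + H + q           ≡⟨ regroup X H q ⟩
    H + q + X           ∎)
    where
    c = count (λ n → (X <? n) ×-dec (q ∣? n)) (suc (X + H))
    b = count (q ∣?_) (suc X)
    b′ = count (q ∣?_) (suc (X + H))
    regroup : ∀ X H q → X + H + q ≡ H + q + X
    regroup = solve-∀
    X≤bq : X ≤ b * q
    X≤bq = +-cancelʳ-≤ q X (b * q) (begin
      X + q           ≡⟨ X+q≡ ⟩
      b * q + r       ≤⟨ +-monoʳ-≤ (b * q) (<⇒≤ r<q) ⟩
      b * q + q       ∎)

  -- Sieving an interval by squares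

  count-mono : ∀ {P Q : ℕ → Set} (P? : Decidable P) (Q? : Decidable Q) →
    (∀ {n} → P n → Q n) → ∀ m → count P? m ≤ count Q? m
  count-mono P? Q? P⊆Q zero = z≤n
  count-mono P? Q? P⊆Q (suc m) with P? m
  ... | no ¬Pm = ≤-trans (≤-reflexive (count-reject P? ¬Pm)) (≤-trans (count-mono P? Q? P⊆Q m) (count-suc-≤ Q? m))
  ... | yes Pm = ≤-trans (≤-reflexive (count-accept P? Pm))
    (≤-trans (s≤s (count-mono P? Q? P⊆Q m)) (≤-reflexive (sym (count-accept Q? (P⊆Q Pm)))))

  -- No square of 2 , … , m + 1 divides n.
  Avoids : ℕ → ℕ → Set
  Avoids m n = ∀ {y} → y < m → ¬ ((2 + y) * (2 + y) ∣ n)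

  avoids? : ∀ m → Decidable (Avoids m)
  avoids? m n = allUpTo? (λ y → ¬? ((2 + y) * (2 + y) ∣? n)) m

  -- As `i ≥ 2`, `a * a` divides `a ^ i`, so one condition on squares serves every exponent.
  avoids-root : ∀ {m n i} a → 2 ≤ i → Avoids m n → 1 < a → a ^ i ∣ n → 2 + m ≤ a
  avoids-root {m} {n} {suc (suc i)} a@(suc (suc y)) _ avoids _ a^i∣n with y <? m
  ... | yes y<m = contradiction (∣-trans (divides (a ^ i) (trans (sym (*-assoc a a (a ^ i))) (*-comm (a * a) (a ^ i)))) a^i∣n) (avoids y<m)
  ... | no  y≮m = s≤s (s≤s (≮⇒≥ y≮m))
  avoids-root {i = suc zero} _ (s≤s ())
  avoids-root {i = suc (suc i)} (suc zero) _ _ (s≤s ())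

  -- The invariant is g ≥ H (1/4 + 1/Y) - Y, multiplied by 4Y to stay within ℕ. Sieving by `1 + Y`
  -- removes `c` integers, at most H/(1 + Y)² + 1.
  discard-step : ∀ Y .{{_ : NonZero Y}} H g g′ c → g ≤ g′ + c → c * ((1 + Y) * (1 + Y)) ≤ H + (1 + Y) * (1 + Y) →
    H * Y + 4 * H ≤ 4 * Y * g + 4 * (Y * Y) →
    H * (1 + Y) + 4 * H ≤ 4 * (1 + Y) * g′ + 4 * ((1 + Y) * (1 + Y))
  discard-step Y H g g′ c g≤ c≤ IH = *-cancelˡ-≤ (Y * s) {{m*n≢0 Y s}} (+-cancelʳ-≤ (4 * Y * H + 4 * H) _ _ (begin
    Y * s * (H * s + 4 * H) + (4 * Y * H + 4 * H)              ≡⟨ arith₁ Y H ⟩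
    s * s * (H * Y + 4 * H)                                    ≤⟨ *-monoʳ-≤ (s * s) IH ⟩
    s * s * (4 * Y * g + 4 * (Y * Y))                          ≤⟨ *-monoʳ-≤ (s * s) (+-monoˡ-≤ (4 * (Y * Y)) (*-monoʳ-≤ (4 * Y) g≤)) ⟩
    s * s * (4 * Y * (g′ + c) + 4 * (Y * Y))                   ≡⟨ arith₂ Y g′ c ⟩
    A + 4 * Y * (c * (s * s))                                  ≤⟨ +-monoʳ-≤ A (*-monoʳ-≤ (4 * Y) c≤) ⟩
    -- The added `4 * H` is the telescoping slack H (1/Y - 1/(1 + Y) - 1/(1 + Y)²) = H/(Y (1 + Y)²),
    -- scaled by 4Y (1 + Y)².
    A + 4 * Y * (H + s * s)                                    ≤⟨ m≤m+n _ (4 * H) ⟩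
    A + 4 * Y * (H + s * s) + 4 * H                            ≡⟨ arith₃ Y H g′ ⟩
    Y * s * (4 * s * g′ + 4 * (s * s)) + (4 * Y * H + 4 * H)   ∎))
    where
    s = 1 + Y
    A = s * s * (4 * Y * g′ + 4 * (Y * Y))
    arith₁ : ∀ Y H → Y * (1 + Y) * (H * (1 + Y) + 4 * H) + (4 * Y * H + 4 * H) ≡ (1 + Y) * (1 + Y) * (H * Y + 4 * H)
    arith₁ = solve-∀
    arith₂ : ∀ Y g c → (1 + Y) * (1 + Y) * (4 * Y * (g + c) + 4 * (Y * Y))
      ≡ (1 + Y) * (1 + Y) * (4 * Y * g + 4 * (Y * Y)) + 4 * Y * (c * ((1 + Y) * (1 + Y)))
    arith₂ = solve-∀
    arith₃ : ∀ Y H g → (1 + Y) * (1 + Y) * (4 * Y * g + 4 * (Y * Y)) + 4 * Y * (H + (1 + Y) * (1 + Y)) + 4 * H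
      ≡ Y * (1 + Y) * (4 * (1 + Y) * g + 4 * ((1 + Y) * (1 + Y))) + (4 * Y * H + 4 * H)
    arith₃ = solve-∀

  above∧avoids? : ∀ X m → Decidable (λ n → X < n × Avoids m n)
  above∧avoids? X m n = (X <? n) ×-dec avoids? m n

  module _ (X H : ℕ) where

    private
      g : ℕ → ℕ
      g m = count (above∧avoids? X m) (suc (X + H))

      c : ℕ → ℕ
      c m = count (λ n → (X <? n) ×-dec ((2 + m) * (2 + m) ∣? n)) (suc (X + H))

      H≤g0 : H ≤ g 0
      H≤g0 = begin
        H                                   ≡⟨ count-> X H ⟨
        count (X <?_) (suc (X + H))         ≤⟨ count-mono (X <?_) (above∧avoids? X 0) (λ X<n → X<n , λ ()) (suc (X + H)) ⟩
        g 0                                 ∎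

      g≤g+c : ∀ m → g m ≤ g (suc m) + c m
      g≤g+c m = count-⊎ (above∧avoids? X m) (above∧avoids? X (suc m)) (λ n → (X <? n) ×-dec ((2 + m) * (2 + m) ∣? n)) split (suc (X + H))
        where
        split : ∀ {n} → X < n × Avoids m n → (X < n × Avoids (suc m) n) ⊎ (X < n × (2 + m) * (2 + m) ∣ n)
        split {n} (X<n , avoids) with (2 + m) * (2 + m) ∣? n
        ... | yes sq∣n = inj₂ (X<n , sq∣n)
        ... | no  sq∤n = inj₁ (X<n , λ y<1+m → extend (m≤n⇒m<n∨m≡n (s≤s⁻¹ y<1+m)))
          where
          extend : ∀ {y} → y < m ⊎ y ≡ m → ¬ ((2 + y) * (2 + y) ∣ n)
          extend (inj₁ y<m)  = avoids y<m
          extend (inj₂ refl) = sq∤n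

      c-bound : ∀ m → c m * ((2 + m) * (2 + m)) ≤ H + (2 + m) * (2 + m)
      c-bound m = count-multiples-interval ((2 + m) * (2 + m)) X H

      -- With Y = m + 2, this says that at most H (3/4 − 1/Y) + Y numbers have
      -- been discarded; 1/(Y+1)² ≤ 1/Y − 1/(Y+1) makes it inductive.
      g-bound : ∀ m → H * (2 + m) + 4 * H ≤ 4 * (2 + m) * g (suc m) + 4 * ((2 + m) * (2 + m))
      -- At Y = 2 a loss of H/4 + 2 is allowed, and the multiples of 4 cost at most H/4 + 1; the
      -- spare 1 is the `8` added in the last inequality.
      g-bound zero = +-cancelʳ-≤ (2 * H) _ _ (begin
        H * 2 + 4 * H + 2 * H                    ≡⟨ arith₁ H ⟩
        8 * H                                    ≤⟨ *-monoʳ-≤ 8 (≤-trans H≤g0 (g≤g+c 0)) ⟩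
        8 * (g 1 + c 0)                          ≡⟨ arith₂ (g 1) (c 0) ⟩
        8 * g 1 + 2 * (c 0 * 4)                  ≤⟨ +-monoʳ-≤ (8 * g 1) (*-monoʳ-≤ 2 (c-bound 0)) ⟩
        8 * g 1 + 2 * (H + 4)                    ≤⟨ m≤m+n _ 8 ⟩
        8 * g 1 + 2 * (H + 4) + 8                ≡⟨ arith₃ (g 1) H ⟩
        4 * 2 * g 1 + 4 * (2 * 2) + 2 * H        ∎)
        where
        arith₁ : ∀ H → H * 2 + 4 * H + 2 * H ≡ 8 * H
        arith₁ = solve-∀
        arith₂ : ∀ g c → 8 * (g + c) ≡ 8 * g + 2 * (c * 4)
        arith₂ = solve-∀
        arith₃ : ∀ g H → 8 * g + 2 * (H + 4) + 8 ≡ 4 * 2 * g + 4 * (2 * 2) + 2 * H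
        arith₃ = solve-∀
      g-bound (suc m) = discard-step (2 + m) H (g (1 + m)) (g (2 + m)) (c (1 + m)) (g≤g+c (1 + m)) (c-bound (1 + m)) (g-bound m)

      g-linear : ∀ m → H ≤ 4 * g m + 4 * (1 + m)
      g-linear zero    = ≤-trans H≤g0 (≤-trans (m≤m+n (g 0) (3 * g 0)) (m≤m+n _ _))
      g-linear (suc m) = *-cancelˡ-≤ (2 + m) (begin
        (2 + m) * H                                         ≡⟨ *-comm (2 + m) H ⟩
        H * (2 + m)                                         ≤⟨ m≤m+n _ (4 * H) ⟩
        H * (2 + m) + 4 * H                                 ≤⟨ g-bound m ⟩
        4 * (2 + m) * g (suc m) + 4 * ((2 + m) * (2 + m))   ≡⟨ arith (2 + m) (g (suc m)) ⟩
        (2 + m) * (4 * g (suc m) + 4 * (2 + m))             ∎)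
        where
        arith : ∀ Y g → 4 * Y * g + 4 * (Y * Y) ≡ Y * (4 * g + 4 * Y)
        arith = solve-∀

    -- The sieve stops at `1 + m` = ⌊H/8⌋. Then `4 * (1 + m)` is at most H/2 in `g-linear`, so at
    -- least H/8 integers survive, while the first root not excluded, `2 + m`, still exceeds H/8.
    many-avoid : 8 ≤ H → ∃ λ m → H < 8 * (2 + m) × H ≤ 8 * count (above∧avoids? X m) (suc (X + H))
    many-avoid 8≤H with H / 8 | m≡m%n+[m/n]*n H 8 | m%n<n H 8
    ... | zero  | H≡ | H%8<8 = contradiction 8≤H (<⇒≱ (subst (_< 8) (sym (trans H≡ (+-identityʳ _))) H%8<8))
    ... | suc m | H≡ | H%8<8 = m , H<8w , +-cancelʳ-≤ H H (8 * g m) (begin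
      H + H                                ≤⟨ +-mono-≤ (g-linear m) (g-linear m) ⟩
      4 * g m + 4 * (1 + m) + (4 * g m + 4 * (1 + m)) ≡⟨ arith₁ (g m) (1 + m) ⟩
      8 * g m + (1 + m) * 8                ≤⟨ +-monoʳ-≤ (8 * g m) (≤-trans (m≤n+m _ _) (≤-reflexive (sym H≡))) ⟩
      8 * g m + H                          ∎)
      where
      arith₁ : ∀ g Y → 4 * g + 4 * Y + (4 * g + 4 * Y) ≡ 8 * g + Y * 8
      arith₁ = solve-∀
      arith₂ : ∀ m → 8 + (1 + m) * 8 ≡ 8 * (2 + m)
      arith₂ = solve-∀
      H<8w : H < 8 * (2 + m)
      H<8w = begin-strict
        H                           ≡⟨ H≡ ⟩
        H % 8 + (1 + m) * 8         <⟨ +-monoˡ-< ((1 + m) * 8) H%8<8 ⟩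
        8 + (1 + m) * 8             ≡⟨ arith₂ m ⟩
        8 * (2 + m)                 ∎

module Reals (em : ExcludedMiddle 0ℓ) (R : CompleteOrderedField) where

  open Arithmetic using (count; power-divisors; d-bound; Avoids; avoids-root; above∧avoids?; many-avoid)

  open import Algebra.Bundles using (CommutativeRing)
  open import Algebra.Solver.Ring.AlmostCommutativeRing using (fromCommutativeRing; _-Raw-AlmostCommutative⟶_)
  import Algebra.Solver.Ring as RingSolver
  import Algebra.Properties.Semiring.Mult as Mult
  import Algebra.Properties.Ring as RingProperties
  open import Data.Empty using (⊥)
  open import Data.Integer.Base as ℤ using (ℤ; +_; -[1+_])
  open import Data.Integer.Properties as ℤ using ()
  open import Data.List.Base using (List; []; _∷_; _∷ʳ_; filter; length; upTo)
  open import Data.List.Membership.Propositional using (_∈_)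
  open import Data.List.Membership.Propositional.Properties using (∈-upTo⁻)
  open import Data.List.Properties using (upTo-∷ʳ)
  open import Data.List.Relation.Unary.Any using (here; there)
  open import Data.Maybe.Base using (Maybe; just; nothing)
  open import Data.Nat.Base using (zero; suc; _!)
  open import Data.Nat.Divisibility using (_∣_)
  open import Data.Nat.Properties as ℕ using ()
  open import Data.Product.Base using (_,_; proj₁; proj₂)
  open import Data.Sum.Base using (_⊎_; inj₁; inj₂)
  open import Function.Base using (_∘_)
  open import Relation.Binary.Bundles using (Poset)
  open import Relation.Binary.PropositionalEquality.Core as ≡ using (_≡_)
  open import Relation.Binary.Structures using (IsTotalOrder)
  open import Relation.Nullary using (¬_; yes; no; contradiction)
  open import Relation.Nullary.Decidable using (_×-dec_)
  open import Relation.Unary using (Decidable)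

  open Analysis em R
  open CommutativeRing commutativeRing
    using ( refl; sym; trans; reflexive; +-cong; +-congˡ; +-congʳ; *-cong; *-congˡ; *-congʳ; -‿cong
          ; +-identityˡ; +-identityʳ; *-identityˡ; *-identityʳ; +-comm; *-comm; +-assoc; *-assoc
          ; -‿inverseʳ; zeroˡ; zeroʳ; distribʳ; semiring; ring)
  open IsTotalOrder isTotalOrder
    using (antisym; total; isPartialOrder) renaming (refl to ≤-refl; reflexive to ≤-reflexive; trans to ≤-trans)

  poset : Poset 0ℓ 0ℓ 0ℓ
  poset = record { isPartialOrder = isPartialOrder }

  open import Relation.Binary.Reasoning.PartialOrder poset

  -- Ordered field arithmetic

  module ℝ× = Mult semiring
  module ℝR = RingProperties ring

  -- Integer coefficients for the ring solver

  fromℕ-+ : ∀ m n → fromℕ (m ℕ.+ n) ≈ fromℕ m + fromℕ n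
  fromℕ-+ = ℝ×.×-homo-+ 1#

  fromℕ-* : ∀ m n → fromℕ (m ℕ.* n) ≈ fromℕ m * fromℕ n
  fromℕ-* = ℝ×.×1-homo-*

  -- 1 is sent to 1# itself, so that solver constants match both 0#, 1# and the
  -- numerals fromℕ n with n ≥ 2 definitionally.
  fromℕ′ : ℕ → ℝ
  fromℕ′ 1 = 1#
  fromℕ′ n = fromℕ n

  fromℕ′≈fromℕ : ∀ n → fromℕ′ n ≈ fromℕ n
  fromℕ′≈fromℕ zero          = refl
  fromℕ′≈fromℕ (suc zero)    = sym (+-identityʳ 1#)
  fromℕ′≈fromℕ (suc (suc n)) = refl

  -- The solver normalises over coefficients whose equality test has to compute, which is why they
  -- are integers mapped into `ℝ`.
  fromℤ : ℤ → ℝ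
  fromℤ (+ n)    = fromℕ′ n
  fromℤ -[1+ n ] = - fromℕ (suc n)

  private
    cancel-suc : ∀ a b → a - b ≈ (1# + a) - (1# + b)
    cancel-suc a b = sym (begin-equality
      (1# + a) - (1# + b)     ≈⟨ +-congˡ (sym (ℝR.-‿+-comm 1# b)) ⟩
      (1# + a) + (- 1# - b)   ≈⟨ +-congʳ (+-comm 1# a) ⟩
      (a + 1#) + (- 1# - b)   ≈⟨ +-assoc a 1# _ ⟩
      a + (1# + (- 1# - b))   ≈⟨ +-congˡ (sym (+-assoc 1# (- 1#) (- b))) ⟩
      a + ((1# - 1#) - b)     ≈⟨ +-congˡ (+-congʳ (-‿inverseʳ 1#)) ⟩
      a + (0# - b)            ≈⟨ +-congˡ (+-identityˡ (- b)) ⟩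
      a - b                   ∎)

  fromℤ-⊖ : ∀ m n → fromℤ (m ℤ.⊖ n) ≈ fromℕ m - fromℕ n
  fromℤ-⊖ m zero = begin-equality
    fromℕ′ m        ≈⟨ fromℕ′≈fromℕ m ⟩
    fromℕ m         ≈⟨ +-identityʳ _ ⟨
    fromℕ m + 0#    ≈⟨ +-congˡ ℝR.-0#≈0# ⟨
    fromℕ m - 0#    ∎
  fromℤ-⊖ zero (suc n) = sym (+-identityˡ _)
  fromℤ-⊖ (suc m) (suc n) = begin-equality
    fromℤ (suc m ℤ.⊖ suc n)    ≡⟨ ≡.cong fromℤ (ℤ.[1+m]⊖[1+n]≡m⊖n m n) ⟩
    fromℤ (m ℤ.⊖ n)            ≈⟨ fromℤ-⊖ m n ⟩
    fromℕ m - fromℕ n          ≈⟨ cancel-suc (fromℕ m) (fromℕ n) ⟩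
    fromℕ (suc m) - fromℕ (suc n) ∎

  fromℤ-+ : ∀ i j → fromℤ (i ℤ.+ j) ≈ fromℤ i + fromℤ j
  fromℤ-+ (+ m) (+ n) = begin-equality
    fromℕ′ (m ℕ.+ n)      ≈⟨ fromℕ′≈fromℕ (m ℕ.+ n) ⟩
    fromℕ (m ℕ.+ n)       ≈⟨ fromℕ-+ m n ⟩
    fromℕ m + fromℕ n     ≈⟨ +-cong (fromℕ′≈fromℕ m) (fromℕ′≈fromℕ n) ⟨
    fromℕ′ m + fromℕ′ n   ∎
  fromℤ-+ (+ m) -[1+ n ] = trans (fromℤ-⊖ m (suc n)) (+-congʳ (sym (fromℕ′≈fromℕ m)))
  fromℤ-+ -[1+ m ] (+ n) = begin-equality
    fromℤ (n ℤ.⊖ suc m)            ≈⟨ fromℤ-⊖ n (suc m) ⟩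
    fromℕ n - fromℕ (suc m)        ≈⟨ +-comm _ _ ⟩
    - fromℕ (suc m) + fromℕ n      ≈⟨ +-congˡ (fromℕ′≈fromℕ n) ⟨
    - fromℕ (suc m) + fromℕ′ n     ∎
  fromℤ-+ -[1+ m ] -[1+ n ] = begin-equality
    - fromℕ (suc (suc (m ℕ.+ n)))          ≡⟨ ≡.cong (λ k → - fromℕ (suc k)) (ℕ.+-suc m n) ⟨
    - fromℕ (suc m ℕ.+ suc n)              ≈⟨ -‿cong (fromℕ-+ (suc m) (suc n)) ⟩
    - (fromℕ (suc m) + fromℕ (suc n))      ≈⟨ ℝR.-‿+-comm _ _ ⟨
    - fromℕ (suc m) - fromℕ (suc n)        ∎

  fromℤ-neg : ∀ i → fromℤ (ℤ.- i) ≈ - fromℤ i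
  fromℤ-neg (+ zero)          = sym ℝR.-0#≈0#
  fromℤ-neg (+ suc zero)      = -‿cong (+-identityʳ 1#)
  fromℤ-neg (+ suc (suc n))   = refl
  fromℤ-neg -[1+ n ]          = trans (fromℕ′≈fromℕ (suc n)) (sym (ℝR.-‿involutive _))

  fromℤ-pos-* : ∀ m j → fromℤ (+ m ℤ.* j) ≈ fromℕ′ m * fromℤ j
  fromℤ-pos-* m (+ n) = begin-equality
    fromℤ (+ m ℤ.* + n)         ≡⟨ ≡.cong fromℤ (ℤ.pos-* m n) ⟨
    fromℕ′ (m ℕ.* n)            ≈⟨ fromℕ′≈fromℕ (m ℕ.* n) ⟩
    fromℕ (m ℕ.* n)             ≈⟨ fromℕ-* m n ⟩
    fromℕ m * fromℕ n           ≈⟨ *-cong (fromℕ′≈fromℕ m) (fromℕ′≈fromℕ n) ⟨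
    fromℕ′ m * fromℕ′ n         ∎
  fromℤ-pos-* m -[1+ n ] = begin-equality
    fromℤ (+ m ℤ.* ℤ.- (+ suc n))  ≡⟨ ≡.cong fromℤ (ℤ.neg-distribʳ-* (+ m) (+ suc n)) ⟨
    fromℤ (ℤ.- (+ m ℤ.* + suc n))  ≈⟨ fromℤ-neg (+ m ℤ.* + suc n) ⟩
    - fromℤ (+ m ℤ.* + suc n)      ≈⟨ -‿cong (fromℤ-pos-* m (+ suc n)) ⟩
    - (fromℕ′ m * fromℕ′ (suc n))  ≈⟨ ℝR.-‿distribʳ-* _ _ ⟩
    fromℕ′ m * - fromℕ′ (suc n)    ≈⟨ *-congˡ (-‿cong (fromℕ′≈fromℕ (suc n))) ⟩
    fromℕ′ m * - fromℕ (suc n)     ∎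

  fromℤ-* : ∀ i j → fromℤ (i ℤ.* j) ≈ fromℤ i * fromℤ j
  fromℤ-* (+ m) j = fromℤ-pos-* m j
  fromℤ-* -[1+ m ] j = begin-equality
    fromℤ (ℤ.- (+ suc m) ℤ.* j)    ≡⟨ ≡.cong fromℤ (ℤ.neg-distribˡ-* (+ suc m) j) ⟨
    fromℤ (ℤ.- (+ suc m ℤ.* j))    ≈⟨ fromℤ-neg (+ suc m ℤ.* j) ⟩
    - fromℤ (+ suc m ℤ.* j)        ≈⟨ -‿cong (fromℤ-pos-* (suc m) j) ⟩
    - (fromℕ′ (suc m) * fromℤ j)   ≈⟨ ℝR.-‿distribˡ-* _ _ ⟩
    - fromℕ′ (suc m) * fromℤ j     ≈⟨ *-congʳ (-‿cong (fromℕ′≈fromℕ (suc m))) ⟩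
    - fromℕ (suc m) * fromℤ j      ∎

  private
    fromℤ-homomorphism : ℤ.+-*-rawRing -Raw-AlmostCommutative⟶ fromCommutativeRing commutativeRing
    fromℤ-homomorphism = record
      { ⟦_⟧    = fromℤ
      ; +-homo = fromℤ-+
      ; *-homo = fromℤ-*
      ; -‿homo = fromℤ-neg
      ; 0-homo = refl
      ; 1-homo = refl
      }

    fromℤ-≟ : ∀ i j → Maybe (fromℤ i ≈ fromℤ j)
    fromℤ-≟ i j with i ℤ.≟ j
    ... | yes i≡j = just (reflexive (≡.cong fromℤ i≡j))
    ... | no  _   = nothing

  open RingSolver ℤ.+-*-rawRing (fromCommutativeRing commutativeRing) fromℤ-homomorphism fromℤ-≟ 
    using (solve; con; _:+_; _:*_; _:-_; :-_; _:=_)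

  -- Order and division

  y-x≥0⇒x≤y : ∀ {x y} → 0# ≤ y - x → x ≤ y
  y-x≥0⇒x≤y {x} {y} 0≤y-x = begin
    x             ≈⟨ +-identityˡ x ⟨
    0# + x        ≤⟨ +-monoˡ-≤ x 0≤y-x ⟩
    (y - x) + x   ≈⟨ solve 2 (λ x y → (y :- x) :+ x := y) refl x y ⟩
    y             ∎

  x≤y⇒y-x≥0 : ∀ {x y} → x ≤ y → 0# ≤ y - x
  x≤y⇒y-x≥0 {x} {y} x≤y = begin
    0#      ≈⟨ -‿inverseʳ x ⟨
    x - x   ≤⟨ +-monoˡ-≤ (- x) x≤y ⟩
    y - x   ∎

  -- The format of most inequalities below: a visibly non-negative certificate `c`, identified with
  -- the difference by the ring solver.
  ≤-by : ∀ {x y c} → 0# ≤ c → c ≈ y - x → x ≤ y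
  ≤-by 0≤c c≈y-x = y-x≥0⇒x≤y (≤-trans 0≤c (≤-reflexive c≈y-x))

  ≰⇒> : ∀ {x y} → ¬ (x ≤ y) → y < x
  ≰⇒> {x} {y} x≰y with total x y
  ... | inj₁ x≤y = contradiction x≤y x≰y
  ... | inj₂ y≤x = y≤x , λ y≈x → x≰y (≤-reflexive (sym y≈x))

  <⇒≱ : ∀ {x y} → x < y → ¬ (y ≤ x)
  <⇒≱ (x≤y , x≉y) y≤x = x≉y (antisym x≤y y≤x)

  <⇒≤ : ∀ {x y} → x < y → x ≤ y
  <⇒≤ = proj₁

  ≤-<-connex : ∀ x y → x ≤ y ⊎ y < x
  ≤-<-connex x y with em {x ≤ y}
  ... | yes x≤y = inj₁ x≤y
  ... | no  x≰y = inj₂ (≰⇒> x≰y)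

  ≮⇒≥ : ∀ {x y} → ¬ (y < x) → x ≤ y
  ≮⇒≥ {x} {y} y≮x with ≤-<-connex x y
  ... | inj₁ x≤y = x≤y
  ... | inj₂ y<x = contradiction y<x y≮x

  <-≤-trans : ∀ {x y z} → x < y → y ≤ z → x < z
  <-≤-trans x<y y≤z = begin-strict _ <⟨ x<y ⟩ _ ≤⟨ y≤z ⟩ _ ∎

  ≤-<-trans : ∀ {x y z} → x ≤ y → y < z → x < z
  ≤-<-trans x≤y y<z = begin-strict _ ≤⟨ x≤y ⟩ _ <⟨ y<z ⟩ _ ∎

  x<y⇒y-x>0 : ∀ {x y} → x < y → 0# < y - x
  x<y⇒y-x>0 {x} {y} (x≤y , x≉y) = x≤y⇒y-x≥0 x≤y , λ 0≈y-x → x≉y (begin-equality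
    x             ≈⟨ +-identityˡ x ⟨
    0# + x        ≈⟨ +-congʳ 0≈y-x ⟩
    (y - x) + x   ≈⟨ solve 2 (λ x y → (y :- x) :+ x := y) refl x y ⟩
    y             ∎)

  y-x>0⇒x<y : ∀ {x y} → 0# < y - x → x < y
  y-x>0⇒x<y {x} {y} (0≤y-x , 0≉y-x) = y-x≥0⇒x≤y 0≤y-x , λ x≈y → 0≉y-x (begin-equality
    0#     ≈⟨ -‿inverseʳ y ⟨
    y - y  ≈⟨ +-congˡ (-‿cong (sym x≈y)) ⟩
    y - x  ∎)

  <-by : ∀ {x y c} → 0# < c → c ≈ y - x → x < y
  <-by 0<c c≈y-x = y-x>0⇒x<y (<-≤-trans 0<c (≤-reflexive c≈y-x))

  +-nonNeg : ∀ {x y} → 0# ≤ x → 0# ≤ y → 0# ≤ x + y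
  +-nonNeg {x} {y} 0≤x 0≤y = begin
    0#      ≤⟨ 0≤y ⟩
    y       ≈⟨ +-identityˡ y ⟨
    0# + y  ≤⟨ +-monoˡ-≤ y 0≤x ⟩
    x + y   ∎

  +-pos-nonNeg : ∀ {x y} → 0# < x → 0# ≤ y → 0# < x + y
  +-pos-nonNeg {x} {y} 0<x 0≤y = <-≤-trans 0<x
    (≤-by 0≤y (solve 2 (λ x y → y := (x :+ y) :- x) refl x y))

  +-mono-≤ : ∀ {x y u v} → x ≤ y → u ≤ v → x + u ≤ y + v
  +-mono-≤ {x} {y} {u} {v} x≤y u≤v = ≤-by (+-nonNeg (x≤y⇒y-x≥0 x≤y) (x≤y⇒y-x≥0 u≤v))
    (solve 4 (λ x y u v → (y :- x) :+ (v :- u) := (y :+ v) :- (x :+ u)) refl x y u v)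

  *-monoˡ-≤ : ∀ {x y z} → 0# ≤ z → x ≤ y → z * x ≤ z * y
  *-monoˡ-≤ {x} {y} {z} 0≤z x≤y = ≤-by (*-nonNeg 0≤z (x≤y⇒y-x≥0 x≤y))
    (solve 3 (λ x y z → z :* (y :- x) := z :* y :- z :* x) refl x y z)

  *-monoʳ-≤ : ∀ {x y z} → 0# ≤ z → x ≤ y → x * z ≤ y * z
  *-monoʳ-≤ {x} {y} {z} 0≤z x≤y = ≤-by (*-nonNeg (x≤y⇒y-x≥0 x≤y) 0≤z)
    (solve 3 (λ x y z → (y :- x) :* z := y :* z :- x :* z) refl x y z)

  *-mono-≤ : ∀ {x y u v} → 0# ≤ x → 0# ≤ u → x ≤ y → u ≤ v → x * u ≤ y * v
  *-mono-≤ 0≤x 0≤u x≤y u≤v =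
    ≤-trans (*-monoˡ-≤ 0≤x u≤v) (*-monoʳ-≤ (≤-trans 0≤u u≤v) x≤y)

  neg-anti-≤ : ∀ {x y} → x ≤ y → - y ≤ - x
  neg-anti-≤ {x} {y} x≤y = ≤-by (x≤y⇒y-x≥0 x≤y) (solve 2 (λ x y → y :- x := :- x :- (:- y)) refl x y)

  *-pos : ∀ {x y} → 0# < x → 0# < y → 0# < x * y
  *-pos {x} {y} (0≤x , 0≉x) (0≤y , 0≉y) = *-nonNeg 0≤x 0≤y , λ 0≈xy → 0≉x (begin-equality
    0#                 ≈⟨ zeroˡ _ ⟨
    0# * y ⁻¹          ≈⟨ *-congʳ 0≈xy ⟩
    x * y * y ⁻¹       ≈⟨ *-assoc x y _ ⟩
    x * (y * y ⁻¹)     ≈⟨ *-congˡ (*-inverseʳ y (0≉y ∘ sym)) ⟩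
    x * 1#             ≈⟨ *-identityʳ x ⟩
    x                  ∎)

  0≤x² : ∀ x → 0# ≤ x * x
  0≤x² x with total 0# x
  ... | inj₁ 0≤x = *-nonNeg 0≤x 0≤x
  ... | inj₂ x≤0 = ≤-trans (*-nonNeg (x≤y⇒y-x≥0 x≤0) (x≤y⇒y-x≥0 x≤0))
    (≤-reflexive (solve 1 (λ x → (con (+ 0) :- x) :* (con (+ 0) :- x) := x :* x) refl x))

  0≤1 : 0# ≤ 1#
  0≤1 = ≤-trans (0≤x² 1#) (≤-reflexive (*-identityˡ 1#))

  0<1 : 0# < 1#
  0<1 = 0≤1 , 0≉1

  fromℕ-nonNeg : ∀ n → 0# ≤ fromℕ n
  fromℕ-nonNeg zero    = ≤-refl
  fromℕ-nonNeg (suc n) = +-nonNeg 0≤1 (fromℕ-nonNeg n)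

  fromℕ-pos : ∀ {n} → 0 ℕ.< n → 0# < fromℕ n
  fromℕ-pos {suc n} _ = +-pos-nonNeg 0<1 (fromℕ-nonNeg n)

  fromℕ-mono-≤ : ∀ {m n} → m ℕ.≤ n → fromℕ m ≤ fromℕ n
  fromℕ-mono-≤ {n = n} ℕ.z≤n = fromℕ-nonNeg n
  fromℕ-mono-≤ (ℕ.s≤s m≤n) = +-mono-≤ ≤-refl (fromℕ-mono-≤ m≤n)

  fromℕ-cancel-≤ : ∀ {m n} → fromℕ m < fromℕ (suc n) → m ℕ.≤ n
  fromℕ-cancel-≤ {m} {n} m<1+n with m ℕ.≤? n
  ... | yes m≤n = m≤n
  ... | no  m≰n = contradiction (fromℕ-mono-≤ (ℕ.≰⇒> m≰n)) (<⇒≱ m<1+n)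

  fromℕ-^ : ∀ m k → fromℕ (m ℕ.^ k) ≈ fromℕ m ^ k
  fromℕ-^ m zero    = +-identityʳ 1#
  fromℕ-^ m (suc k) = trans (fromℕ-* m (m ℕ.^ k)) (*-congˡ (fromℕ-^ m k))

  pos⇒≉0 : ∀ {x} → 0# < x → ¬ (x ≈ 0#)
  pos⇒≉0 (_ , 0≉x) x≈0 = 0≉x (sym x≈0)

  *-inverse-pos : ∀ {x} → 0# < x → x * x ⁻¹ ≈ 1#
  *-inverse-pos {x} 0<x = *-inverseʳ x (pos⇒≉0 0<x)

  *-cancelˡ-≤ : ∀ {x y z} → 0# < z → z * x ≤ z * y → x ≤ y
  *-cancelˡ-≤ {x} {y} {z} 0<z zx≤zy with ≤-<-connex x y
  ... | inj₁ x≤y = x≤y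
  ... | inj₂ y<x = contradiction zx≤zy (<⇒≱
    (<-by (*-pos 0<z (x<y⇒y-x>0 y<x)) (solve 3 (λ x y z → z :* (x :- y) := z :* x :- z :* y) refl x y z)))

  *-cancelˡ-≈ : ∀ {x y z} → 0# < z → z * x ≈ z * y → x ≈ y
  *-cancelˡ-≈ 0<z zx≈zy =
    antisym (*-cancelˡ-≤ 0<z (≤-reflexive zx≈zy)) (*-cancelˡ-≤ 0<z (≤-reflexive (sym zx≈zy)))

  pos-cancelˡ : ∀ {x y} → 0# ≤ x → 0# < x * y → 0# < y
  pos-cancelˡ {x} {y} 0≤x 0<xy with ≤-<-connex y 0#
  ... | inj₁ y≤0 = contradiction
    (≤-trans (*-monoˡ-≤ 0≤x y≤0) (≤-reflexive (zeroʳ x))) (<⇒≱ 0<xy)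
  ... | inj₂ 0<y = 0<y

  ⁻¹-pos : ∀ {x} → 0# < x → 0# < x ⁻¹
  ⁻¹-pos {x} 0<x = pos-cancelˡ (<⇒≤ 0<x) (<-≤-trans 0<1 (≤-reflexive (sym (*-inverse-pos 0<x))))

  *-/-cancel : ∀ {x y} → 0# < y → y * (x / y) ≈ x
  *-/-cancel {x} {y} 0<y = begin-equality
    y * (x * y ⁻¹)   ≈⟨ solve 3 (λ x y z → y :* (x :* z) := x :* (y :* z)) refl x y (y ⁻¹) ⟩
    x * (y * y ⁻¹)   ≈⟨ *-congˡ (*-inverse-pos 0<y) ⟩
    x * 1#           ≈⟨ *-identityʳ x ⟩
    x                ∎

  /-pos : ∀ {x y} → 0# < x → 0# < y → 0# < x / y
  /-pos 0<x 0<y = *-pos 0<x (⁻¹-pos 0<y)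

  /-nonNeg : ∀ {x y} → 0# ≤ x → 0# < y → 0# ≤ x / y
  /-nonNeg 0≤x 0<y = *-nonNeg 0≤x (<⇒≤ (⁻¹-pos 0<y))

  0<2 : 0# < fromℕ 2
  0<2 = fromℕ-pos {2} (ℕ.s≤s ℕ.z≤n)

  -- Otherwise the naturals have a supremum `s`; as `n + 1 ≤ s` for every `n`, `s - 1#` is a smaller
  -- upper bound.
  archimedean : ∀ x → ∃ λ n → x < fromℕ n
  archimedean x with em {∃ λ n → x < fromℕ n}
  ... | yes ∃n = ∃n
  ... | no  ∄n = contradiction s≤s-1 (<⇒≱ s-1<s)
    where
    IsNatural : ℝ → Set
    IsNatural z = ∃ λ n → z ≈ fromℕ n

    bounded : UpperBound IsNatural x
    bounded z (n , z≈n) with ≤-<-connex z x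
    ... | inj₁ z≤x = z≤x
    ... | inj₂ x<z = contradiction (n , <-≤-trans x<z (≤-reflexive z≈n)) ∄n

    supremum : ∃ λ s → UpperBound IsNatural s × (∀ u → UpperBound IsNatural u → s ≤ u)
    supremum = complete IsNatural (0# , 0 , refl) (x , bounded)

    s = proj₁ supremum

    s≤s-1 : s ≤ s - 1#
    s≤s-1 = proj₂ (proj₂ supremum) (s - 1#) λ z (n , z≈n) →
      ≤-by (x≤y⇒y-x≥0 (proj₁ (proj₂ supremum) (fromℕ (suc n)) (suc n , refl)))
        (trans (solve 2 (λ s n → s :- (con (+ 1) :+ n) := s :- con (+ 1) :- n) refl s (fromℕ n))
          (+-congˡ (-‿cong (sym z≈n))))

    s-1<s : s - 1# < s
    s-1<s = <-by 0<1 (solve 1 (λ s → con (+ 1) := s :- (s :- con (+ 1))) refl s)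

  the-spec : ∀ {A : Set} (default : A) (P : A → Set) → ∃ P → P (the default P)
  the-spec default P ∃P with em {∃ P}
  ... | yes (_ , Pa) = Pa
  ... | no  ∄P       = contradiction ∃P ∄P

  floor-spec : ∀ {y} → 0# ≤ y → fromℕ (floor y) ≤ y × y < fromℕ (suc (floor y))
  floor-spec {y} 0≤y = the-spec 0 (λ m → fromℕ m ≤ y × y < fromℕ (suc m))
    (search (proj₁ (archimedean y)) (proj₂ (archimedean y)))
    where
    search : ∀ n → y < fromℕ n → ∃ λ m → fromℕ m ≤ y × y < fromℕ (suc m)
    search zero    y<0 = contradiction 0≤y (<⇒≱ y<0)
    search (suc n) y<1+n with ≤-<-connex (fromℕ n) y
    ... | inj₁ n≤y = n , n≤y , y<1+n
    ... | inj₂ y<n = search n y<n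

  half : ℝ → ℝ
  half x = x / fromℕ 2

  half-pos : ∀ {x} → 0# < x → 0# < half x
  half-pos 0<x = /-pos 0<x 0<2

  half+half : ∀ x → half x + half x ≈ x
  half+half x = trans (solve 1 (λ y → y :+ y := con (+ 2) :* y) refl (half x)) (*-/-cancel 0<2)

  half<x : ∀ {x} → 0# < x → half x < x
  half<x {x} 0<x = <-by (half-pos 0<x) (trans
    (solve 1 (λ y → y := y :+ y :- y) refl (half x)) (+-congʳ (half+half x)))

  ≤-pos⇒≤0 : ∀ {x} → (∀ δ → 0# < δ → x ≤ δ) → x ≤ 0#
  ≤-pos⇒≤0 {x} x≤δ with ≤-<-connex x 0#
  ... | inj₁ x≤0 = x≤0
  ... | inj₂ 0<x = contradiction (x≤δ (half x) (half-pos 0<x)) (<⇒≱ (half<x 0<x))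

  -- ∣ x ∣ ≤ b
  infix 4 _∈±_
  _∈±_ : ℝ → ℝ → Set
  x ∈± b = - b ≤ x × x ≤ b

  ∈±-resp : ∀ {x y b} → x ≈ y → x ∈± b → y ∈± b
  ∈±-resp x≈y (-b≤x , x≤b) = ≤-trans -b≤x (≤-reflexive x≈y) , ≤-trans (≤-reflexive (sym x≈y)) x≤b

  ∈±-mono : ∀ {x a b} → a ≤ b → x ∈± a → x ∈± b
  ∈±-mono a≤b (-a≤x , x≤a) = ≤-trans (neg-anti-≤ a≤b) -a≤x , ≤-trans x≤a a≤b

  ∈±-+ : ∀ {x y a b} → x ∈± a → y ∈± b → x + y ∈± a + b
  ∈±-+ {x} {y} {a} {b} (-a≤x , x≤a) (-b≤y , y≤b) =
    ≤-trans (≤-reflexive (solve 2 (λ a b → :- (a :+ b) := (:- a) :+ (:- b)) refl a b)) (+-mono-≤ -a≤x -b≤y) ,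
    +-mono-≤ x≤a y≤b

  ∈±-neg : ∀ {x a} → x ∈± a → - x ∈± a
  ∈±-neg {x} {a} (-a≤x , x≤a) = neg-anti-≤ x≤a ,
    ≤-trans (neg-anti-≤ -a≤x) (≤-reflexive (solve 1 (λ a → :- (:- a) := a) refl a))

  -- 2(ab − xy) = (a − x)(b + y) + (a + x)(b − y)
  ∈±⇒*≤* : ∀ {x y a b} → x ∈± a → y ∈± b → x * y ≤ a * b
  ∈±⇒*≤* {x} {y} {a} {b} (-a≤x , x≤a) (-b≤y , y≤b) = *-cancelˡ-≤ 0<2
    (≤-by (+-nonNeg (*-nonNeg (x≤y⇒y-x≥0 x≤a) (x≤y⇒y-x≥0 -b≤y)) (*-nonNeg (x≤y⇒y-x≥0 -a≤x) (x≤y⇒y-x≥0 y≤b)))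
      (solve 4 (λ x y a b → (a :- x) :* (y :- (:- b)) :+ (x :- (:- a)) :* (b :- y)
                            := con (+ 2) :* (a :* b) :- con (+ 2) :* (x :* y)) refl x y a b))

  ∈±-* : ∀ {x y a b} → x ∈± a → y ∈± b → x * y ∈± a * b
  ∈±-* {x} {y} {a} {b} x∈ y∈ =
    ≤-by (x≤y⇒y-x≥0 (∈±⇒*≤* (∈±-neg x∈) y∈))
      (solve 4 (λ x y a b → a :* b :- (:- x) :* y := x :* y :- (:- (a :* b))) refl x y a b) ,
    ∈±⇒*≤* x∈ y∈

  nonNeg-∈± : ∀ {x} → 0# ≤ x → x ∈± x
  nonNeg-∈± {x} 0≤x = ≤-by (+-nonNeg 0≤x 0≤x) (solve 1 (λ x → x :+ x := x :- (:- x)) refl x) , ≤-refl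

  absolute-bound : ∀ x → ∃ λ a → 0# ≤ a × x ∈± a
  absolute-bound x with total 0# x
  ... | inj₁ 0≤x = x , 0≤x , nonNeg-∈± 0≤x
  ... | inj₂ x≤0 = - x , 0≤-x , ∈±-resp (solve 1 (λ x → :- (:- x) := x) refl x) (∈±-neg (nonNeg-∈± 0≤-x))
    where 0≤-x = ≤-by (x≤y⇒y-x≥0 x≤0) (solve 1 (λ x → con (+ 0) :- x := :- x :- con (+ 0)) refl x)

  -- Null sequences

  -- Convergence to `l` is handled as nullity of `s n - l`, so that limit laws become sums and
  -- bounded multiples of null sequences. A record type lets unification recover `s` from `Null s`.
  record Null (s : ℕ → ℝ) : Set where
    field eventually : ∀ δ → 0# < δ → ∃ λ M → ∀ n → M ℕ.≤ n → s n ∈± δ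
  open Null

  null-resp : ∀ {s t} → (∀ n → s n ≈ t n) → Null s → Null t
  null-resp s≈t null-s .eventually δ 0<δ with null-s .eventually δ 0<δ
  ... | M , bound = M , λ n M≤n → ∈±-resp (s≈t n) (bound n M≤n)

  null-squeeze : ∀ {s t} → (∀ n → s n ∈± t n) → Null t → Null s
  null-squeeze s∈±t null-t .eventually δ 0<δ with null-t .eventually δ 0<δ
  ... | M , bound = M , λ n M≤n → ∈±-mono (proj₂ (bound n M≤n)) (s∈±t n)

  null-+ : ∀ {s t} → Null s → Null t → Null (λ n → s n + t n)
  null-+ null-s null-t .eventually δ 0<δ with null-s .eventually (half δ) (half-pos 0<δ) | null-t .eventually (half δ) (half-pos 0<δ)
  ... | M , s-bound | M′ , t-bound = M ℕ.⊔ M′ , λ n M⊔M′≤n → ∈±-mono (≤-reflexive (half+half δ))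
    (∈±-+ (s-bound n (ℕ.m⊔n≤o⇒m≤o M M′ M⊔M′≤n)) (t-bound n (ℕ.m⊔n≤o⇒n≤o M M′ M⊔M′≤n)))

  null-neg : ∀ {s} → Null s → Null (λ n → - s n)
  null-neg null-s .eventually δ 0<δ with null-s .eventually δ 0<δ
  ... | M , bound = M , λ n M≤n → ∈±-neg (bound n M≤n)

  null-* : ∀ {s t : ℕ → ℝ} {K} → 0# < K → Null s → (∀ n → t n ∈± K) → Null (λ n → s n * t n)
  null-* {K = K} 0<K null-s t∈±K .eventually δ 0<δ with null-s .eventually (δ / K) (/-pos 0<δ 0<K)
  ... | M , bound = M , λ n M≤n → ∈±-mono (≤-reflexive (trans (*-comm _ K) (*-/-cancel 0<K)))
    (∈±-* (bound n M≤n) (t∈±K n))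

  null-double : ∀ {s} → Null s → Null (λ n → s (n ℕ.+ n))
  null-double null-s .eventually δ 0<δ with null-s .eventually δ 0<δ
  ... | M , bound = M , λ n M≤n → bound (n ℕ.+ n) (ℕ.≤-trans M≤n (ℕ.m≤m+n n n))

  null-constant : ∀ {c} → Null (λ _ → c) → c ≈ 0#
  null-constant {c} null-c = antisym (≤-pos⇒≤0 λ δ 0<δ → proj₂ (at δ 0<δ))
    (≤-by (x≤y⇒y-x≥0 (≤-pos⇒≤0 λ δ 0<δ → proj₂ (∈±-neg (at δ 0<δ))))
          (solve 1 (λ c → con (+ 0) :- (:- c) := c :- con (+ 0)) refl c))
    where
    at : ∀ δ → 0# < δ → c ∈± δ
    at δ 0<δ with null-c .eventually δ 0<δ
    ... | M , bound = bound M ℕ.≤-refl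

  ⟶⇒null : ∀ {s l} → s ⟶ l → Null (λ n → s n - l)
  ⟶⇒null {s} {l} s⟶l .eventually δ 0<δ with s⟶l δ 0<δ
  ... | M , near = M , λ n M≤n →
    ≤-by (x≤y⇒y-x≥0 (<⇒≤ (proj₁ (near n M≤n)))) (solve 3 (λ l δ s → s :- (l :- δ) := s :- l :- (:- δ)) refl l δ (s n)) ,
    ≤-by (x≤y⇒y-x≥0 (<⇒≤ (proj₂ (near n M≤n)))) (solve 3 (λ l δ s → l :+ δ :- s := δ :- (s :- l)) refl l δ (s n))

  null⇒⟶ : ∀ {s l} → Null (λ n → s n - l) → s ⟶ l
  null⇒⟶ {s} {l} null δ 0<δ with null .eventually (half δ) (half-pos 0<δ)
  ... | M , bound = M , λ n M≤n →
    <-by (+-pos-nonNeg δ-η>0 (x≤y⇒y-x≥0 (proj₁ (bound n M≤n))))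
      (solve 4 (λ l δ η s → δ :- η :+ (s :- l :- (:- η)) := s :- (l :- δ)) refl l δ (half δ) (s n)) ,
    <-by (+-pos-nonNeg δ-η>0 (x≤y⇒y-x≥0 (proj₂ (bound n M≤n))))
      (solve 4 (λ l δ η s → δ :- η :+ (η :- (s :- l)) := l :+ δ :- s) refl l δ (half δ) (s n))
    where δ-η>0 = x<y⇒y-x>0 (half<x 0<δ)

  null-lower : ∀ {s : ℕ → ℝ} {l c} M → (∀ n → M ℕ.≤ n → c ≤ s n) → Null (λ n → s n - l) → c ≤ l
  null-lower {s} {l} {c} M c≤s null = ≤-by (x≤y⇒y-x≥0 (≤-pos⇒≤0 c-l≤δ))
    (solve 2 (λ c l → con (+ 0) :- (c :- l) := l :- c) refl c l)
    where
    c-l≤δ : ∀ δ → 0# < δ → c - l ≤ δ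
    c-l≤δ δ 0<δ with null .eventually δ 0<δ
    ... | M′ , bound = ≤-trans (+-monoˡ-≤ (- l) (c≤s (M ℕ.⊔ M′) (ℕ.m≤m⊔n M M′))) (proj₂ (bound (M ℕ.⊔ M′) (ℕ.m≤n⊔m M M′)))

  null-upper : ∀ {s : ℕ → ℝ} {l c} → (∀ n → s n ≤ c) → Null (λ n → s n - l) → l ≤ c
  null-upper {s} {l} {c} s≤c null = ≤-by (x≤y⇒y-x≥0 (null-lower {λ n → - s n} { - l} 0 (λ n _ → neg-anti-≤ (s≤c n))
      (null-resp (λ n → solve 2 (λ s l → :- (s :- l) := :- s :- (:- l)) refl (s n) l) (null-neg null))))
    (solve 2 (λ l c → :- l :- (:- c) := c :- l) refl l c)

  increasing⇒mono : ∀ {s : ℕ → ℝ} → (∀ n → s n ≤ s (suc n)) → ∀ {m n} → m ℕ.≤ n → s m ≤ s n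
  increasing⇒mono {s} increasing m≤n = go (ℕ.≤⇒≤′ m≤n)
    where
    go : ∀ {m n} → m ℕ.≤′ n → s m ≤ s n
    go ℕ.≤′-refl = ≤-refl
    go (ℕ.≤′-step m≤′n) = ≤-trans (go m≤′n) (increasing _)

  monotone-convergence : ∀ {s : ℕ → ℝ} {B} → (∀ n → s n ≤ s (suc n)) → (∀ n → s n ≤ B) → ∃ λ l → Null (λ n → s n - l)
  monotone-convergence {s} {B} increasing bounded = l , null
    where
    Value : ℝ → Set
    Value z = ∃ λ n → z ≈ s n

    supremum : ∃ λ l → UpperBound Value l × (∀ u → UpperBound Value u → l ≤ u)
    supremum = complete Value (s 0 , 0 , refl) (B , λ z (n , z≈sn) → ≤-trans (≤-reflexive z≈sn) (bounded n))

    l = proj₁ supremum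

    null : Null (λ n → s n - l)
    null .eventually δ 0<δ with em {∃ λ M → l - δ ≤ s M}
    ... | yes (M , l-δ≤sM) = M , λ n M≤n →
      ≤-by (x≤y⇒y-x≥0 (≤-trans l-δ≤sM (increasing⇒mono increasing M≤n)))
        (solve 3 (λ l δ s → s :- (l :- δ) := s :- l :- (:- δ)) refl l δ (s n)) ,
      ≤-by (+-nonNeg (<⇒≤ 0<δ) (x≤y⇒y-x≥0 (proj₁ (proj₂ supremum) (s n) (n , refl))))
        (solve 3 (λ l δ s → δ :+ (l :- s) := δ :- (s :- l)) refl l δ (s n))
    ... | no  ∄M = contradiction
      (proj₂ (proj₂ supremum) (l - δ) λ z (n , z≈sn) → below n z≈sn)
      (<⇒≱ (<-by 0<δ (solve 2 (λ l δ → δ := l :- (l :- δ)) refl l δ)))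
      where
      below : ∀ {z} n → z ≈ s n → z ≤ l - δ
      below n z≈sn with total (s n) (l - δ)
      ... | inj₁ sn≤ = ≤-trans (≤-reflexive z≈sn) sn≤
      ... | inj₂ ≤sn = contradiction (n , ≤sn) ∄M

  -- Partial sums and Cauchy products

  S : (ℕ → ℝ) → ℕ → ℝ
  S f zero    = 0#
  S f (suc m) = S f m + f m

  ∑-∷ʳ : ∀ ns n f → ∑ (ns ∷ʳ n) f ≈ ∑ ns f + f n
  ∑-∷ʳ []       n f = +-comm (f n) 0#
  ∑-∷ʳ (k ∷ ns) n f = trans (+-congˡ (∑-∷ʳ ns n f)) (sym (+-assoc (f k) (∑ ns f) (f n)))

  ∑-upTo : ∀ f m → ∑ (upTo m) f ≈ S f m
  ∑-upTo f zero    = refl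
  ∑-upTo f (suc m) = begin-equality
    ∑ (upTo (suc m)) f     ≡⟨ ≡.cong (λ ns → ∑ ns f) (upTo-∷ʳ m) ⟨
    ∑ (upTo m ∷ʳ m) f      ≈⟨ ∑-∷ʳ (upTo m) m f ⟩
    ∑ (upTo m) f + f m     ≈⟨ +-congʳ (∑-upTo f m) ⟩
    S f m + f m            ∎

  S-cong : ∀ {f g} → (∀ k → f k ≈ g k) → ∀ m → S f m ≈ S g m
  S-cong f≈g zero    = refl
  S-cong f≈g (suc m) = +-cong (S-cong f≈g m) (f≈g m)

  S-shift : ∀ f m → S f (suc m) ≈ f 0 + S (f ∘ suc) m
  S-shift f zero    = +-comm 0# (f 0)
  S-shift f (suc m) = trans (+-congʳ (S-shift f m)) (+-assoc (f 0) _ _)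

  S-∈± : ∀ {f g} → (∀ k → f k ∈± g k) → ∀ m → S f m ∈± S g m
  S-∈± f∈±g zero    = nonNeg-∈± ≤-refl
  S-∈± f∈±g (suc m) = ∈±-+ (S-∈± f∈±g m) (f∈±g m)

  S-+ : ∀ f g m → S (λ k → f k + g k) m ≈ S f m + S g m
  S-+ f g zero    = sym (+-identityˡ 0#)
  S-+ f g (suc m) = trans (+-congʳ (S-+ f g m))
    (solve 4 (λ x y u v → x :+ y :+ (u :+ v) := x :+ u :+ (y :+ v)) refl (S f m) (S g m) (f m) (g m))

  S-increasing : ∀ {f} → (∀ k → 0# ≤ f k) → ∀ m → S f m ≤ S f (suc m)
  S-increasing {f} 0≤f m = ≤-by (0≤f m) (solve 2 (λ s x → x := s :+ x :- s) refl (S f m) (f m))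

  S-nonNeg : ∀ {f} → (∀ k → 0# ≤ f k) → ∀ m → 0# ≤ S f m
  S-nonNeg 0≤f m = increasing⇒mono (S-increasing 0≤f) {0} {m} ℕ.z≤n

  conv : (ℕ → ℝ) → (ℕ → ℝ) → ℕ → ℝ
  conv u v zero    = u 0 * v 0
  conv u v (suc k) = u 0 * v (suc k) + conv (u ∘ suc) v k

  conv-cong : ∀ {u u′ v v′} → (∀ k → u k ≈ u′ k) → (∀ k → v k ≈ v′ k) → ∀ k → conv u v k ≈ conv u′ v′ k
  conv-cong u≈ v≈ zero    = *-cong (u≈ 0) (v≈ 0)
  conv-cong u≈ v≈ (suc k) = +-cong (*-cong (u≈ 0) (v≈ (suc k))) (conv-cong (u≈ ∘ suc) v≈ k)

  conv-+ˡ : ∀ u u′ v k → conv (λ a → u a + u′ a) v k ≈ conv u v k + conv u′ v k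
  conv-+ˡ u u′ v zero    = distribʳ (v 0) (u 0) (u′ 0)
  conv-+ˡ u u′ v (suc k) = trans (+-congˡ (conv-+ˡ (u ∘ suc) (u′ ∘ suc) v k))
    (solve 5 (λ a b c x y → (a :+ b) :* c :+ (x :+ y) := a :* c :+ x :+ (b :* c :+ y)) refl
      (u 0) (u′ 0) (v (suc k)) (conv (u ∘ suc) v k) (conv (u′ ∘ suc) v k))

  conv-*ˡ : ∀ x u v k → conv (λ a → x * u a) v k ≈ x * conv u v k
  conv-*ˡ x u v zero    = *-assoc x (u 0) (v 0)
  conv-*ˡ x u v (suc k) = trans (+-congˡ (conv-*ˡ x (u ∘ suc) v k))
    (solve 4 (λ x a b c → x :* a :* b :+ x :* c := x :* (a :* b :+ c)) refl x (u 0) (v (suc k)) (conv (u ∘ suc) v k))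

  conv-*ʳ : ∀ x u v k → conv u (λ a → x * v a) k ≈ x * conv u v k
  conv-*ʳ x u v zero    = solve 3 (λ x a b → a :* (x :* b) := x :* (a :* b)) refl x (u 0) (v 0)
  conv-*ʳ x u v (suc k) = trans (+-congˡ (conv-*ʳ x (u ∘ suc) v k))
    (solve 4 (λ x a b c → a :* (x :* b) :+ x :* c := x :* (a :* b :+ c)) refl x (u 0) (v (suc k)) (conv (u ∘ suc) v k))

  -- The coefficients of the formal derivative; the exponential coefficients
  -- are determined by e₀ = 1 and ∂ e = x e.
  ∂ : (ℕ → ℝ) → ℕ → ℝ
  ∂ u k = fromℕ (suc k) * u (suc k)

  -- The Leibniz rule for formal power series. In the induction, the summand 1 of `fromℕ (2 + k)`
  -- yields one extra copy of `conv (u ∘ suc) v`, which turns the derivative of the shifted sequence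
  -- into the shifted derivative of `u`.
  ∂-conv : ∀ u v k → ∂ (conv u v) k ≈ conv (∂ u) v k + conv u (∂ v) k
  ∂-conv u v zero = solve 4 (λ u₀ u₁ v₀ v₁ → (con (+ 1) :+ con (+ 0)) :* (u₀ :* v₁ :+ u₁ :* v₀)
      := (con (+ 1) :+ con (+ 0)) :* u₁ :* v₀ :+ u₀ :* ((con (+ 1) :+ con (+ 0)) :* v₁)) refl (u 0) (u 1) (v 0) (v 1)
  ∂-conv u v (suc k) = begin-equality
    fromℕ (2 ℕ.+ k) * (u 0 * v (2 ℕ.+ k) + conv u⁺ v (suc k))
      ≈⟨ solve 4 (λ n a b c → (con (+ 1) :+ n) :* (a :* b :+ c) := a :* ((con (+ 1) :+ n) :* b) :+ (n :* c) :+ c) refl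
           (fromℕ (suc k)) (u 0) (v (2 ℕ.+ k)) (conv u⁺ v (suc k)) ⟩
    u 0 * ∂ v (suc k) + ∂ (conv u⁺ v) k + (u 1 * v (suc k) + conv (u⁺ ∘ suc) v k)
      ≈⟨ +-congʳ (+-congˡ (∂-conv u⁺ v k)) ⟩
    u 0 * ∂ v (suc k) + (conv (∂ u⁺) v k + conv u⁺ (∂ v) k) + (u 1 * v (suc k) + conv (u⁺ ∘ suc) v k)
      ≈⟨ solve 6 (λ a b c d x y → a :+ (b :+ c) :+ (x :* y :+ d)
                    := (con (+ 1) :+ con (+ 0)) :* x :* y :+ (b :+ d) :+ (a :+ c)) refl
           (u 0 * ∂ v (suc k)) (conv (∂ u⁺) v k) (conv u⁺ (∂ v) k) (conv (u⁺ ∘ suc) v k) (u 1) (v (suc k)) ⟩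
    ∂ u 0 * v (suc k) + (conv (∂ u⁺) v k + conv (u⁺ ∘ suc) v k) + (u 0 * ∂ v (suc k) + conv u⁺ (∂ v) k)
      ≈⟨ +-congʳ (+-congˡ (conv-+ˡ (∂ u⁺) (u⁺ ∘ suc) v k)) ⟨
    ∂ u 0 * v (suc k) + conv (λ a → ∂ u⁺ a + u⁺ (suc a)) v k + (u 0 * ∂ v (suc k) + conv u⁺ (∂ v) k)
      ≈⟨ +-congʳ (+-congˡ (conv-cong shift (λ _ → refl) k)) ⟩
    conv (∂ u) v (suc k) + conv u (∂ v) (suc k) ∎
    where
    u⁺ = u ∘ suc
    shift : ∀ a → ∂ u⁺ a + u⁺ (suc a) ≈ ∂ u (suc a)
    shift a = solve 2 (λ n x → n :* x :+ x := (con (+ 1) :+ n) :* x) refl (fromℕ (suc a)) (u (2 ℕ.+ a))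

  S-conv : ∀ u v m → S (conv u v) (suc m) ≈ u 0 * S v (suc m) + S (conv (u ∘ suc) v) m
  S-conv u v zero = solve 2 (λ a b → con (+ 0) :+ a :* b := a :* (con (+ 0) :+ b) :+ con (+ 0)) refl (u 0) (v 0)
  S-conv u v (suc m) = trans (+-congʳ (S-conv u v m))
    (solve 5 (λ a b c d x → a :* b :+ c :+ (a :* x :+ d) := a :* (b :+ x) :+ (c :+ d)) refl
      (u 0) (S v (suc m)) (S (conv (u ∘ suc) v) m) (conv (u ∘ suc) v m) (v (suc m)))

  -- The corner sum: all `u a * v b` with `a`, `b` below `m` but `a + b` at least `m`.
  product-remainder : (ℕ → ℝ) → (ℕ → ℝ) → ℕ → ℝ
  product-remainder u v m = S u m * S v m - S (conv u v) m

  product-remainder-suc : ∀ u v m →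
    product-remainder u v (suc m) ≈ product-remainder (u ∘ suc) v m + S (u ∘ suc) m * v m
  product-remainder-suc u v m = trans (+-cong (*-congʳ (S-shift u m)) (-‿cong (S-conv u v m)))
    (solve 5 (λ a b c d e → (a :+ b) :* (c :+ d) :- (a :* (c :+ d) :+ e) := b :* c :- e :+ b :* d) refl
      (u 0) (S (u ∘ suc) m) (S v m) (v m) (S (conv (u ∘ suc) v) m))

  -- The defining subtraction would spoil termwise domination; the recursion `product-remainder-suc`
  -- has only sums and products, through which the bounds pass.
  product-remainder-∈± : ∀ {u v ū v̄} → (∀ k → u k ∈± ū k) → (∀ k → v k ∈± v̄ k) →
    ∀ m → product-remainder u v m ∈± product-remainder ū v̄ m
  product-remainder-∈± u∈ v∈ zero = ∈±-resp (sym zero-remainder)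
    (∈±-mono (≤-reflexive (sym zero-remainder)) (nonNeg-∈± ≤-refl))
    where
    zero-remainder : 0# * 0# - 0# ≈ 0#
    zero-remainder = solve 0 (con (+ 0) :* con (+ 0) :- con (+ 0) := con (+ 0)) refl
  product-remainder-∈± {u} {v} {ū} {v̄} u∈ v∈ (suc m) =
    ∈±-resp (sym (product-remainder-suc u v m))
      (∈±-mono (≤-reflexive (sym (product-remainder-suc ū v̄ m)))
        (∈±-+ (product-remainder-∈± (u∈ ∘ suc) v∈ m) (∈±-* (S-∈± (u∈ ∘ suc) m) (v∈ m))))

  -- The box `a < j`, `b < m` lies inside the triangle `a + b < j + m`, and the remaining terms are
  -- non-negative.
  S*S≤S-conv : ∀ {u v} → (∀ k → 0# ≤ u k) → (∀ k → 0# ≤ v k) → ∀ j m → S u j * S v m ≤ S (conv u v) (j ℕ.+ m)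
  S*S≤S-conv {u} {v} 0≤u 0≤v zero m = ≤-trans (≤-reflexive (zeroˡ _)) (S-nonNeg (conv-nonNeg 0≤u) m)
    where
    conv-nonNeg : ∀ {u} → (∀ k → 0# ≤ u k) → ∀ k → 0# ≤ conv u v k
    conv-nonNeg 0≤u zero    = *-nonNeg (0≤u 0) (0≤v 0)
    conv-nonNeg 0≤u (suc k) = +-nonNeg (*-nonNeg (0≤u 0) (0≤v (suc k))) (conv-nonNeg (0≤u ∘ suc) k)
  S*S≤S-conv {u} {v} 0≤u 0≤v (suc j) m = begin
    S u (suc j) * S v m                            ≈⟨ *-congʳ (S-shift u j) ⟩
    (u 0 + S (u ∘ suc) j) * S v m                  ≈⟨ distribʳ _ _ _ ⟩
    u 0 * S v m + S (u ∘ suc) j * S v m            ≤⟨ +-mono-≤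
      (*-monoˡ-≤ (0≤u 0) (increasing⇒mono (S-increasing 0≤v) (ℕ.m≤n+m m (suc j))))
      (S*S≤S-conv (0≤u ∘ suc) 0≤v j m) ⟩
    u 0 * S v (suc (j ℕ.+ m)) + S (conv (u ∘ suc) v) (j ℕ.+ m) ≈⟨ S-conv u v (j ℕ.+ m) ⟨
    S (conv u v) (suc j ℕ.+ m)                     ∎

  -- The exponential series

  e : ℝ → ℕ → ℝ
  e x k = x ^ k / fromℕ (k !)

  !-pos : ∀ k → 0# < fromℕ (k !)
  !-pos k = fromℕ-pos (ℕ.1≤n! k)

  e-zero : ∀ x → e x 0 ≈ 1#
  e-zero x = *-cancelˡ-≈ (!-pos 0) (begin-equality
    fromℕ 1 * e x 0   ≈⟨ *-/-cancel (!-pos 0) ⟩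
    1#                ≈⟨ solve 0 (con (+ 1) := (con (+ 1) :+ con (+ 0)) :* con (+ 1)) refl ⟩
    fromℕ 1 * 1#      ∎)

  ∂-e : ∀ x k → ∂ (e x) k ≈ x * e x k
  ∂-e x k = *-cancelˡ-≈ (!-pos k) (begin-equality
    fromℕ (k !) * (fromℕ (suc k) * e x (suc k))
      ≈⟨ solve 3 (λ a b c → a :* (b :* c) := b :* a :* c) refl (fromℕ (k !)) (fromℕ (suc k)) (e x (suc k)) ⟩
    fromℕ (suc k) * fromℕ (k !) * e x (suc k)       ≈⟨ *-congʳ (fromℕ-* (suc k) (k !)) ⟨
    fromℕ (suc k !) * e x (suc k)                   ≈⟨ *-/-cancel (!-pos (suc k)) ⟩
    x * x ^ k                                       ≈⟨ *-congˡ (*-/-cancel (!-pos k)) ⟨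
    x * (fromℕ (k !) * e x k)
      ≈⟨ solve 3 (λ x a c → x :* (a :* c) := a :* (x :* c)) refl x (fromℕ (k !)) (e x k) ⟩
    fromℕ (k !) * (x * e x k)                       ∎)

  ∂-unique : ∀ {u v x} → u 0 ≈ v 0 → (∀ k → ∂ u k ≈ x * u k) → (∀ k → ∂ v k ≈ x * v k) → ∀ k → u k ≈ v k
  ∂-unique u0≈v0 ∂u ∂v zero    = u0≈v0
  ∂-unique u0≈v0 ∂u ∂v (suc k) = *-cancelˡ-≈ (fromℕ-pos {suc k} (ℕ.s≤s ℕ.z≤n))
    (trans (∂u k) (trans (*-congˡ (∂-unique u0≈v0 ∂u ∂v k)) (sym (∂v k))))

  e-one : ∀ x → e x 1 ≈ x
  e-one x = begin-equality
    e x 1             ≈⟨ solve 1 (λ y → y := (con (+ 1) :+ con (+ 0)) :* y) refl (e x 1) ⟩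
    fromℕ 1 * e x 1   ≈⟨ ∂-e x 0 ⟩
    x * e x 0         ≈⟨ *-congˡ (e-zero x) ⟩
    x * 1#            ≈⟨ *-identityʳ x ⟩
    x                 ∎

  e-cong : ∀ {x y} → x ≈ y → ∀ k → e x k ≈ e y k
  e-cong {x} {y} x≈y = ∂-unique (trans (e-zero x) (sym (e-zero y))) (∂-e x)
    (λ k → trans (∂-e y k) (*-congʳ (sym x≈y)))

  -- Both sides solve the same formal differential equation with the same initial value, so binomial
  -- coefficients never appear.
  e-conv : ∀ x y k → conv (e x) (e y) k ≈ e (x + y) k
  e-conv x y = ∂-unique zeroth leibniz (∂-e (x + y))
    where
    zeroth : e x 0 * e y 0 ≈ e (x + y) 0
    zeroth = trans (*-cong (e-zero x) (e-zero y)) (trans (*-identityˡ 1#) (sym (e-zero (x + y))))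

    leibniz : ∀ k → ∂ (conv (e x) (e y)) k ≈ (x + y) * conv (e x) (e y) k
    leibniz k = begin-equality
      ∂ (conv (e x) (e y)) k                                              ≈⟨ ∂-conv (e x) (e y) k ⟩
      conv (∂ (e x)) (e y) k + conv (e x) (∂ (e y)) k                     ≈⟨ +-cong
        (conv-cong (∂-e x) (λ _ → refl) k) (conv-cong (λ _ → refl) (∂-e y) k) ⟩
      conv (λ a → x * e x a) (e y) k + conv (e x) (λ b → y * e y b) k     ≈⟨ +-cong
        (conv-*ˡ x (e x) (e y) k) (conv-*ʳ y (e x) (e y) k) ⟩
      x * conv (e x) (e y) k + y * conv (e x) (e y) k                     ≈⟨ distribʳ _ x y ⟨
      (x + y) * conv (e x) (e y) k                                        ∎

  ^-nonNeg : ∀ {x} k → 0# ≤ x → 0# ≤ x ^ k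
  ^-nonNeg zero    0≤x = 0≤1
  ^-nonNeg (suc k) 0≤x = *-nonNeg 0≤x (^-nonNeg k 0≤x)

  e-nonNeg : ∀ {x} → 0# ≤ x → ∀ k → 0# ≤ e x k
  e-nonNeg 0≤x k = /-nonNeg (^-nonNeg k 0≤x) (!-pos k)

  e-∈± : ∀ {x a} → x ∈± a → ∀ k → e x k ∈± e a k
  e-∈± {x} {a} x∈±a k = ∈±-* (power k) (nonNeg-∈± (<⇒≤ (⁻¹-pos (!-pos k))))
    where
    power : ∀ k → x ^ k ∈± a ^ k
    power zero    = nonNeg-∈± 0≤1
    power (suc k) = ∈±-* x∈±a (power k)

  -- From K on, the terms at least halve, so S (e a) m + 2 e a m decreases.
  S-e-bound : ∀ {a} → 0# ≤ a → ∀ K → fromℕ 2 * a ≤ fromℕ (suc K) → ∀ m → S (e a) m ≤ S (e a) K + fromℕ 2 * e a K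
  S-e-bound {a} 0≤a K 2a≤1+K m = begin
    S (e a) m                    ≤⟨ increasing⇒mono (S-increasing (e-nonNeg 0≤a)) (ℕ.m≤m+n m K) ⟩
    S (e a) (m ℕ.+ K)            ≤⟨ ≤-by (*-nonNeg (<⇒≤ 0<2) (e-nonNeg 0≤a (m ℕ.+ K)))
                                     (solve 2 (λ s t → t := s :+ t :- s) refl (S (e a) (m ℕ.+ K)) (fromℕ 2 * e a (m ℕ.+ K))) ⟩
    F (m ℕ.+ K)                  ≤⟨ decreasing m ⟩
    F K                          ∎
    where
    F : ℕ → ℝ
    F m = S (e a) m + fromℕ 2 * e a m

    halving : ∀ k → K ℕ.≤ k → fromℕ 2 * e a (suc k) ≤ e a k
    halving k K≤k = *-cancelˡ-≤ (fromℕ-pos {suc k} (ℕ.s≤s ℕ.z≤n)) (begin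
      fromℕ (suc k) * (fromℕ 2 * e a (suc k))
        ≈⟨ solve 2 (λ n x → n :* (con (+ 2) :* x) := con (+ 2) :* (n :* x)) refl (fromℕ (suc k)) (e a (suc k)) ⟩
      fromℕ 2 * ∂ (e a) k            ≈⟨ *-congˡ (∂-e a k) ⟩
      fromℕ 2 * (a * e a k)          ≈⟨ *-assoc (fromℕ 2) a (e a k) ⟨
      fromℕ 2 * a * e a k            ≤⟨ *-monoʳ-≤ (e-nonNeg 0≤a k) (≤-trans 2a≤1+K (fromℕ-mono-≤ (ℕ.s≤s K≤k))) ⟩
      fromℕ (suc k) * e a k          ∎)

    decreasing : ∀ m → F (m ℕ.+ K) ≤ F K
    decreasing zero    = ≤-refl
    decreasing (suc m) = ≤-trans
      (≤-by (x≤y⇒y-x≥0 (halving (m ℕ.+ K) (ℕ.m≤n+m K m)))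
        (solve 3 (λ s x y → x :- con (+ 2) :* y := s :+ con (+ 2) :* x :- (s :+ x :+ con (+ 2) :* y)) refl
          (S (e a) (m ℕ.+ K)) (e a (m ℕ.+ K)) (e a (suc m ℕ.+ K))))
      (decreasing m)

  S-e-bounded : ∀ {a} → 0# ≤ a → ∃ λ B → ∀ m → S (e a) m ≤ B
  S-e-bounded {a} 0≤a with archimedean (fromℕ 2 * a)
  ... | K , 2a<K = S (e a) K + fromℕ 2 * e a K , S-e-bound 0≤a K
    (≤-trans (<⇒≤ 2a<K) (fromℕ-mono-≤ (ℕ.n≤1+n K)))

  S-e-converges-nonNeg : ∀ {a} → 0# ≤ a → ∃ λ l → Null (λ m → S (e a) m - l)
  S-e-converges-nonNeg 0≤a = monotone-convergence (S-increasing (e-nonNeg 0≤a)) (proj₂ (S-e-bounded 0≤a))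

  -- Absolute convergence without absolute values: with `x ∈± a`, the series of `e x k + e a k` has
  -- non-negative terms and bounded sums, and the convergent series of `e a k` is subtracted again.
  S-e-converges : ∀ x → ∃ λ l → Null (λ m → S (e x) m - l)
  S-e-converges x = dominated (absolute-bound x)
    where
    dominated : (∃ λ a → 0# ≤ a × x ∈± a) → ∃ λ l → Null (λ m → S (e x) m - l)
    dominated (a , 0≤a , x∈±a) = proj₁ sum-limit - proj₁ a-limit , null-resp
      (λ m → difference (S (e x) m) (S (e a) m) _ _ _ (S-+ (e x) (e a) m))
      (null-+ (proj₂ sum-limit) (null-neg (proj₂ a-limit)))
      where
      sum-nonNeg : ∀ k → 0# ≤ e x k + e a k
      sum-nonNeg k = ≤-by (x≤y⇒y-x≥0 (proj₁ (e-∈± x∈±a k)))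
        (solve 2 (λ x a → x :- (:- a) := x :+ a :- con (+ 0)) refl (e x k) (e a k))

      B = proj₁ (S-e-bounded 0≤a)
      S≤B = proj₂ (S-e-bounded 0≤a)

      sum-bounded : ∀ m → S (λ k → e x k + e a k) m ≤ B + B
      sum-bounded m = ≤-trans (≤-reflexive (S-+ (e x) (e a) m))
        (+-mono-≤ (≤-trans (proj₂ (S-∈± (e-∈± x∈±a) m)) (S≤B m)) (S≤B m))

      sum-limit : ∃ λ l → Null (λ m → S (λ k → e x k + e a k) m - l)
      sum-limit = monotone-convergence (S-increasing sum-nonNeg) sum-bounded

      a-limit : ∃ λ l → Null (λ m → S (e a) m - l)
      a-limit = S-e-converges-nonNeg 0≤a

      difference : ∀ s t u l l′ → u ≈ s + t → u - l′ - (t - l) ≈ s - (l′ - l)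
      difference s t u l l′ u≈s+t = trans (+-congʳ (+-congʳ u≈s+t))
        (solve 4 (λ s t l l′ → s :+ t :- l′ :- (t :- l) := s :- (l′ :- l)) refl s t l l′)

  -- The exponential function: functional equation and growth

  exp-spec : ∀ x → Null (λ m → S (e x) m - exp x)
  exp-spec x = null-resp (λ m → +-congʳ (∑-upTo (e x) m)) (⟶⇒null
    (the-spec 0# (λ l → (λ m → ∑ (upTo m) (e x)) ⟶ l)
      (proj₁ (S-e-converges x) , null⇒⟶ (null-resp (λ m → +-congʳ (sym (∑-upTo (e x) m))) (proj₂ (S-e-converges x))))))

  x-y≈0⇒x≈y : ∀ {x y} → x - y ≈ 0# → x ≈ y
  x-y≈0⇒x≈y {x} {y} x-y≈0 = antisym (≤-by (≤-reflexive (trans (sym ℝR.-0#≈0#) (-‿cong (sym x-y≈0))))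
      (solve 2 (λ x y → :- (x :- y) := y :- x) refl x y))
    (y-x≥0⇒x≤y (≤-reflexive (sym x-y≈0)))

  -- A definite description need not respect `_≈_`; here uniqueness of limits makes it do so.
  exp-cong : ∀ {x y} → x ≈ y → exp x ≈ exp y
  exp-cong {x} {y} x≈y = x-y≈0⇒x≈y (null-constant (null-resp
    (λ m → trans (+-congʳ (+-congʳ (S-cong (e-cong (sym x≈y)) m)))
      (solve 3 (λ s x y → s :- y :- (s :- x) := x :- y) refl (S (e x) m) (exp x) (exp y)))
    (null-+ (exp-spec y) (null-neg (exp-spec x)))))

  -- With `x ∈± a` and `y ∈± b`, the corner sum is dominated by the one for `a` and `b`. Its box of
  -- side `m` fits into the triangle of side `m + m`, so it is at most `T (m + m) - T m`, which is
  -- null because `T` converges.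
  e-product-null : ∀ x y → Null (product-remainder (e x) (e y))
  e-product-null x y = dominated (absolute-bound x) (absolute-bound y)
    where
    difference : ∀ s t l → s - l - (t - l) ≈ s - t
    difference = solve 3 (λ s t l → s :- l :- (t :- l) := s :- t) refl

    dominated : (∃ λ a → 0# ≤ a × x ∈± a) → (∃ λ b → 0# ≤ b × y ∈± b) → Null (product-remainder (e x) (e y))
    dominated (a , 0≤a , x∈±a) (b , 0≤b , y∈±b) = null-squeeze (λ m →
        ∈±-mono (remainder≤tail m) (product-remainder-∈± (e-∈± x∈±a) (e-∈± y∈±b) m)) tail-null
      where
      T : ℕ → ℝ
      T = S (conv (e a) (e b))

      T-null : Null (λ m → T m - exp (a + b))
      T-null = null-resp (λ m → +-congʳ (S-cong (λ k → sym (e-conv a b k)) m)) (exp-spec (a + b))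

      tail-null : Null (λ m → T (m ℕ.+ m) - T m)
      tail-null = null-resp (λ m → difference (T (m ℕ.+ m)) (T m) (exp (a + b)))
        (null-+ (null-double T-null) (null-neg T-null))

      remainder≤tail : ∀ m → product-remainder (e a) (e b) m ≤ T (m ℕ.+ m) - T m
      remainder≤tail m = +-monoˡ-≤ (- T m) (S*S≤S-conv (e-nonNeg 0≤a) (e-nonNeg 0≤b) m m)

  -- The constant `exp x * exp y - exp (x + y)` is a combination of null sequences: the two errors
  -- of the factors, the error of the Cauchy product, and the corner sum.
  exp-+ : ∀ x y → exp (x + y) ≈ exp x * exp y
  exp-+ x y = sym (x-y≈0⇒x≈y (null-constant (null-resp
      (λ m → identity (S (e x) m) (S (e y) m) (S (conv (e x) (e y)) m) (exp x) (exp y) (exp (x + y)))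
      (null-+ (null-+ sum-null (null-neg (null-+ (x-null (absolute-bound y)) (y-null (absolute-bound (exp x))))))
        (e-product-null x y)))))
    where
    sum-null : Null (λ m → S (conv (e x) (e y)) m - exp (x + y))
    sum-null = null-resp (λ m → +-congʳ (S-cong (λ k → sym (e-conv x y k)) m)) (exp-spec (x + y))

    b≤1+b : ∀ b → b ≤ 1# + b
    b≤1+b b = ≤-by 0≤1 (solve 1 (λ b → con (+ 1) := con (+ 1) :+ b :- b) refl b)

    x-null : (∃ λ b → 0# ≤ b × y ∈± b) → Null (λ m → (S (e x) m - exp x) * S (e y) m)
    x-null (b , 0≤b , y∈±b) = null-* (+-pos-nonNeg 0<1 (S≤B 0)) (exp-spec x)
      (λ m → ∈±-mono (≤-trans (S≤B m) (b≤1+b B)) (S-∈± (e-∈± y∈±b) m))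
      where
      B = proj₁ (S-e-bounded 0≤b)
      S≤B = proj₂ (S-e-bounded 0≤b)

    y-null : (∃ λ c → 0# ≤ c × exp x ∈± c) → Null (λ m → (S (e y) m - exp y) * exp x)
    y-null (c , 0≤c , expx∈±c) = null-* (+-pos-nonNeg 0<1 0≤c) (exp-spec y) (λ _ → ∈±-mono (b≤1+b c) expx∈±c)

    identity : ∀ s t p u v w → (p - w) - ((s - u) * t + (t - v) * u) + (s * t - p) ≈ u * v - w
    identity = solve 6 (λ s t p u v w → (p :- w) :- ((s :- u) :* t :+ (t :- v) :* u) :+ (s :* t :- p) := u :* v :- w) refl

  1+x≤exp : ∀ {x} → 0# ≤ x → 1# + x ≤ exp x
  1+x≤exp {x} 0≤x = null-lower 2 (λ n 2≤n → ≤-trans (≤-reflexive two-terms)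
    (increasing⇒mono (S-increasing (e-nonNeg 0≤x)) 2≤n)) (exp-spec x)
    where
    two-terms : 1# + x ≈ S (e x) 2
    two-terms = sym (+-cong (trans (+-identityˡ _) (e-zero x)) (e-one x))

  -- The case `K = 1` of `S-e-bound`. It stands in for continuity of `exp` in the construction of
  -- logarithms.
  exp≤1+2x : ∀ {x} → 0# ≤ x → x ≤ 1# → exp x ≤ 1# + fromℕ 2 * x
  exp≤1+2x {x} 0≤x x≤1 = ≤-trans (null-upper (S-e-bound 0≤x 1 2x≤2) (exp-spec x))
    (≤-reflexive (+-cong (trans (+-identityˡ _) (e-zero x)) (*-congˡ (e-one x))))
    where
    2x≤2 : fromℕ 2 * x ≤ fromℕ 2
    2x≤2 = ≤-trans (*-monoˡ-≤ (<⇒≤ 0<2) x≤1) (≤-reflexive (*-identityʳ _))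

  exp-0 : exp 0# ≈ 1#
  exp-0 = antisym
    (≤-trans (exp≤1+2x ≤-refl 0≤1) (≤-reflexive (solve 0 (con (+ 1) :+ con (+ 2) :* con (+ 0) := con (+ 1)) refl)))
    (≤-trans (≤-reflexive (sym (+-identityʳ 1#))) (1+x≤exp ≤-refl))

  1≤exp : ∀ {x} → 0# ≤ x → 1# ≤ exp x
  1≤exp {x} 0≤x = ≤-trans (≤-by 0≤x (solve 1 (λ x → x := con (+ 1) :+ x :- con (+ 1)) refl x)) (1+x≤exp 0≤x)

  x<exp : ∀ {x} → 0# ≤ x → x < exp x
  x<exp {x} 0≤x = <-≤-trans (<-by 0<1 (solve 1 (λ x → con (+ 1) := con (+ 1) :+ x :- x) refl x)) (1+x≤exp 0≤x)

  exp-inverseʳ : ∀ x → exp x * exp (- x) ≈ 1#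
  exp-inverseʳ x = begin-equality
    exp x * exp (- x)   ≈⟨ exp-+ x (- x) ⟨
    exp (x - x)         ≈⟨ exp-cong (-‿inverseʳ x) ⟩
    exp 0#              ≈⟨ exp-0 ⟩
    1#                  ∎

  exp-nonNeg : ∀ x → 0# ≤ exp x
  exp-nonNeg x = begin
    0#                         ≤⟨ 0≤x² (exp (half x)) ⟩
    exp (half x) * exp (half x) ≈⟨ exp-+ (half x) (half x) ⟨
    exp (half x + half x)      ≈⟨ exp-cong (half+half x) ⟩
    exp x                      ∎

  exp-pos : ∀ x → 0# < exp x
  exp-pos x = pos-cancelˡ (exp-nonNeg (- x)) (<-≤-trans 0<1
    (≤-reflexive (trans (sym (exp-inverseʳ x)) (*-comm _ _))))

  exp-difference : ∀ x y → exp y ≈ exp x * exp (y - x)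
  exp-difference x y = trans (exp-cong (solve 2 (λ x y → y := x :+ (y :- x)) refl x y)) (exp-+ x (y - x))

  exp-mono-≤ : ∀ {x y} → x ≤ y → exp x ≤ exp y
  exp-mono-≤ {x} {y} x≤y = begin
    exp x                 ≈⟨ *-identityʳ _ ⟨
    exp x * 1#            ≤⟨ *-monoˡ-≤ (exp-nonNeg x) (1≤exp (x≤y⇒y-x≥0 x≤y)) ⟩
    exp x * exp (y - x)   ≈⟨ exp-difference x y ⟨
    exp y                 ∎

  exp-cancel-< : ∀ {x y} → exp x < exp y → x < y
  exp-cancel-< ex<ey = ≰⇒> λ y≤x → <⇒≱ ex<ey (exp-mono-≤ y≤x)

  exp-cancel-≤ : ∀ {x y} → exp x ≤ exp y → x ≤ y
  exp-cancel-≤ {x} {y} ex≤ey = ≮⇒≥ λ y<x → contradiction ratio≤1 (<⇒≱ (<-≤-trans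
    (<-by (x<y⇒y-x>0 y<x) (solve 1 (λ z → z := con (+ 1) :+ z :- con (+ 1)) refl (x - y)))
    (1+x≤exp (x≤y⇒y-x≥0 (<⇒≤ y<x)))))
    where
    ratio≤1 : exp (x - y) ≤ 1#
    ratio≤1 = *-cancelˡ-≤ (exp-pos y) (≤-trans (≤-reflexive (sym (exp-difference y x)))
      (≤-trans ex≤ey (≤-reflexive (sym (*-identityʳ _)))))

  exp-fromℕ-* : ∀ n x → exp (fromℕ n * x) ≈ exp x ^ n
  exp-fromℕ-* zero    x = trans (exp-cong (zeroˡ x)) exp-0
  exp-fromℕ-* (suc n) x = begin-equality
    exp ((1# + fromℕ n) * x)     ≈⟨ exp-cong (solve 2 (λ n x → (con (+ 1) :+ n) :* x := x :+ n :* x) refl (fromℕ n) x) ⟩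
    exp (x + fromℕ n * x)        ≈⟨ exp-+ x (fromℕ n * x) ⟩
    exp x * exp (fromℕ n * x)    ≈⟨ *-congˡ (exp-fromℕ-* n x) ⟩
    exp x * exp x ^ n            ∎

  -- The square of x/2 ≤ exp (x/2). It is the superlinear growth on which the thresholds for log log
  -- x rest.
  x²≤4exp : ∀ {x} → 0# ≤ x → x * x ≤ fromℕ 4 * exp x
  x²≤4exp {x} 0≤x = begin
    x * x                                     ≈⟨ *-cong (half+half x) (half+half x) ⟨
    (half x + half x) * (half x + half x)     ≈⟨ solve 1 (λ y → (y :+ y) :* (y :+ y) := con (+ 4) :* (y :* y)) refl (half x) ⟩
    fromℕ 4 * (half x * half x)               ≤⟨ *-monoˡ-≤ (fromℕ-nonNeg 4) (*-mono-≤ 0≤half 0≤half half≤exp half≤exp) ⟩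
    fromℕ 4 * (exp (half x) * exp (half x))   ≈⟨ *-congˡ (exp-+ (half x) (half x)) ⟨
    fromℕ 4 * exp (half x + half x)           ≈⟨ *-congˡ (exp-cong (half+half x)) ⟩
    fromℕ 4 * exp x                           ∎
    where
    0≤half = /-nonNeg 0≤x 0<2
    half≤exp = <⇒≤ (x<exp 0≤half)

  -- The logarithm

  -- The witness `g / (g + c)` meets both bounds at once, also for `c ≈ 0#`.
  small-step : ∀ {c g} → 0# ≤ c → 0# < g → ∃ λ δ → 0# < δ × δ ≤ 1# × c * δ ≤ g
  small-step {c} {g} 0≤c 0<g = δ , 0<δ ,
    *-cancelˡ-≤ 0<g+c (≤-trans (≤-reflexive (*-/-cancel 0<g+c)) (≤-by 0≤c
      (solve 2 (λ c g → c := (g :+ c) :* con (+ 1) :- g) refl c g))) ,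
    ≤-trans (≤-by (*-nonNeg (<⇒≤ 0<g) (<⇒≤ 0<δ)) (solve 3 (λ c g δ → g :* δ := (g :+ c) :* δ :- c :* δ) refl c g δ))
      (≤-reflexive (*-/-cancel 0<g+c))
    where
    0<g+c = +-pos-nonNeg 0<g 0≤c
    δ = g / (g + c)
    0<δ = /-pos 0<g 0<g+c

  -- An intermediate value argument at the supremum `s` of all `t` with `exp t ≤ y`. If `exp s` were
  -- below `y`, some `s + δ` would still belong to the set; if above, some `s - δ` would still bound
  -- it. The gap fixes `δ` through `exp δ ≤ 1 + 2δ`.
  exp-surjective : ∀ {y} → 1# ≤ y → ∃ λ x → exp x ≈ y
  exp-surjective {y} 1≤y = s , antisym exps≤y y≤exps
    where
    0≤y = ≤-trans 0≤1 1≤y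

    Below : ℝ → Set
    Below t = exp t ≤ y

    bounded : UpperBound Below y
    bounded t expt≤y = ≮⇒≥ λ y<t → contradiction (≤-trans (<⇒≤ (x<exp (≤-trans 0≤y (<⇒≤ y<t)))) expt≤y) (<⇒≱ y<t)

    supremum : ∃ λ s → UpperBound Below s × (∀ u → UpperBound Below u → s ≤ u)
    supremum = complete Below (0# , ≤-trans (≤-reflexive exp-0) 1≤y) (y , bounded)

    s = proj₁ supremum

    y≤exps : y ≤ exp s
    y≤exps = ≮⇒≥ λ exps<y → overshoot (small-step (*-nonNeg (<⇒≤ 0<2) (exp-nonNeg s)) (x<y⇒y-x>0 exps<y))
      where
      overshoot : (∃ λ δ → 0# < δ × δ ≤ 1# × fromℕ 2 * exp s * δ ≤ y - exp s) → ⊥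
      overshoot (δ , 0<δ , δ≤1 , gap) = contradiction
        (proj₁ (proj₂ supremum) (s + δ) (begin
          exp (s + δ)                    ≈⟨ exp-+ s δ ⟩
          exp s * exp δ                  ≤⟨ *-monoˡ-≤ (exp-nonNeg s) (exp≤1+2x (<⇒≤ 0<δ) δ≤1) ⟩
          exp s * (1# + fromℕ 2 * δ)     ≤⟨ ≤-by (x≤y⇒y-x≥0 gap)
            (solve 3 (λ a d y → y :- a :- con (+ 2) :* a :* d := y :- a :* (con (+ 1) :+ con (+ 2) :* d)) refl (exp s) δ y) ⟩
          y                              ∎))
        (<⇒≱ (<-by 0<δ (solve 2 (λ s d → d := s :+ d :- s) refl s δ)))

    exps≤y : exp s ≤ y
    exps≤y = ≮⇒≥ λ y<exps → undershoot (small-step (*-nonNeg (<⇒≤ 0<2) 0≤y) (x<y⇒y-x>0 y<exps))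
      where
      undershoot : (∃ λ δ → 0# < δ × δ ≤ 1# × fromℕ 2 * y * δ ≤ exp s - y) → ⊥
      undershoot (δ , 0<δ , δ≤1 , gap) = contradiction
        (proj₂ (proj₂ supremum) (s - δ) λ t expt≤y → exp-cancel-≤ (≤-trans expt≤y y≤exp))
        (<⇒≱ (<-by 0<δ (solve 2 (λ s d → d := s :- (s :- d)) refl s δ)))
        where
        0<1+2δ : 0# < 1# + fromℕ 2 * δ
        0<1+2δ = +-pos-nonNeg 0<1 (*-nonNeg (<⇒≤ 0<2) (<⇒≤ 0<δ))

        y≤exp : y ≤ exp (s - δ)
        y≤exp = *-cancelˡ-≤ 0<1+2δ (begin
          (1# + fromℕ 2 * δ) * y                ≤⟨ ≤-by (x≤y⇒y-x≥0 gap)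
            (solve 3 (λ a d y → a :- y :- con (+ 2) :* y :* d := a :- (con (+ 1) :+ con (+ 2) :* d) :* y) refl (exp s) δ y) ⟩
          exp s                                 ≈⟨ exp-difference δ s ⟩
          exp δ * exp (s - δ)                   ≤⟨ *-monoʳ-≤ (exp-nonNeg _) (exp≤1+2x (<⇒≤ 0<δ) δ≤1) ⟩
          (1# + fromℕ 2 * δ) * exp (s - δ)      ∎)

  exp-log : ∀ {y} → 1# ≤ y → exp (log y) ≈ y
  exp-log {y} 1≤y = the-spec 0# (λ x → exp x ≈ y) (exp-surjective 1≤y)

  exp<⇒<log : ∀ {x y} → 0# ≤ x → exp x < y → x < log y
  exp<⇒<log 0≤x expx<y = exp-cancel-< (<-≤-trans expx<y (≤-reflexive (sym (exp-log (≤-trans (1≤exp 0≤x) (<⇒≤ expx<y))))))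

  2≤exp1 : fromℕ 2 ≤ exp 1#
  2≤exp1 = ≤-trans (≤-reflexive (solve 0 (con (+ 2) := con (+ 1) :+ con (+ 1)) refl)) (1+x≤exp 0≤1)

  1≤2 : 1# ≤ fromℕ 2
  1≤2 = ≤-by 0≤1 (solve 0 (con (+ 1) := con (+ 2) :- con (+ 1)) refl)

  0≤log2 : 0# ≤ log (fromℕ 2)
  0≤log2 = exp-cancel-≤ (≤-trans (≤-reflexive exp-0) (≤-trans 1≤2 (≤-reflexive (sym (exp-log 1≤2)))))

  log2≤1 : log (fromℕ 2) ≤ 1#
  log2≤1 = exp-cancel-≤ (≤-trans (≤-reflexive (exp-log 1≤2)) 2≤exp1)

  ^-mono-≤ : ∀ {x y} k → 0# ≤ x → x ≤ y → x ^ k ≤ y ^ k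
  ^-mono-≤ zero    0≤x x≤y = ≤-refl
  ^-mono-≤ (suc k) 0≤x x≤y = *-mono-≤ 0≤x (^-nonNeg k 0≤x) x≤y (^-mono-≤ k 0≤x x≤y)

  -- The lower bound in short intervals

  ∑-filter-≥ : ∀ {P Q : ℕ → Set} (P? : Decidable P) (Q? : Decidable Q) {f c} → (∀ n → 0# ≤ f n) → ∀ ns →
    (∀ {n} → n ∈ ns → Q n → P n × c ≤ f n) → fromℕ (length (filter Q? ns)) * c ≤ ∑ (filter P? ns) f
  ∑-filter-≥ P? Q? 0≤f [] Q⊆P = ≤-reflexive (zeroˡ _)
  ∑-filter-≥ P? Q? {f} {c} 0≤f (n ∷ ns) Q⊆P with Q? n | P? n | ∑-filter-≥ P? Q? {f} {c} 0≤f ns (Q⊆P ∘ there)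
  ... | yes Qn | yes Pn | rest = ≤-trans
    (≤-reflexive (solve 2 (λ k c → (con (+ 1) :+ k) :* c := c :+ k :* c) refl (fromℕ (length (filter Q? ns))) c))
    (+-mono-≤ (proj₂ (Q⊆P (here ≡.refl) Qn)) rest)
  ... | yes Qn | no ¬Pn | _    = contradiction (proj₁ (Q⊆P (here ≡.refl) Qn)) ¬Pn
  ... | no _   | no  _  | rest = rest
  ... | no _   | yes _  | rest = ≤-trans rest
    (≤-by (0≤f n) (solve 2 (λ x s → x := x :+ s :- s) refl (f n) (∑ (filter P? ns) f)))

  -- As 8 = 2³ ≤ exp 3, a factor 8 costs 3 in the exponent; hence the `3` in `v` below.
  8exp≤exp+3 : ∀ v → fromℕ 8 * exp v ≤ exp (v + fromℕ 3)
  8exp≤exp+3 v = begin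
    fromℕ 8 * exp v             ≤⟨ *-monoʳ-≤ (exp-nonNeg v) 8≤exp3 ⟩
    exp (fromℕ 3) * exp v       ≈⟨ exp-+ (fromℕ 3) v ⟨
    exp (fromℕ 3 + v)           ≈⟨ exp-cong (+-comm (fromℕ 3) v) ⟩
    exp (v + fromℕ 3)           ∎
    where
    8≤exp3 : fromℕ 8 ≤ exp (fromℕ 3)
    8≤exp3 = begin
      fromℕ 8               ≈⟨ fromℕ-^ 2 3 ⟩
      fromℕ 2 ^ 3           ≤⟨ ^-mono-≤ 3 (<⇒≤ 0<2) 2≤exp1 ⟩
      exp 1# ^ 3            ≈⟨ exp-fromℕ-* 3 1# ⟨
      exp (fromℕ 3 * 1#)    ≈⟨ exp-cong (*-identityʳ (fromℕ 3)) ⟩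
      exp (fromℕ 3)         ∎

  fromℕ-2^ : ∀ k → fromℕ (2 ℕ.^ k) ≈ exp (fromℕ k * log (fromℕ 2))
  fromℕ-2^ k = begin-equality
    fromℕ (2 ℕ.^ k)                 ≈⟨ fromℕ-^ 2 k ⟩
    fromℕ 2 ^ k                     ≈⟨ ^-cong k (exp-log 1≤2) ⟨
    exp (log (fromℕ 2)) ^ k         ≈⟨ exp-fromℕ-* k (log (fromℕ 2)) ⟨
    exp (fromℕ k * log (fromℕ 2))   ∎
    where
    ^-cong : ∀ {x y} k → x ≈ y → x ^ k ≈ y ^ k
    ^-cong zero    x≈y = refl
    ^-cong (suc k) x≈y = *-cong x≈y (^-cong k x≈y)

  /-≤⇒≤-* : ∀ {a b x} → 0# < b → a / b ≤ x → a ≤ b * x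
  /-≤⇒≤-* 0<b a/b≤x = ≤-trans (≤-reflexive (sym (*-/-cancel 0<b))) (*-monoˡ-≤ (<⇒≤ 0<b) a/b≤x)

  reciprocal≤ : ∀ {i} → 2 ℕ.≤ i → fromℕ 2 * (1# / fromℕ i) ≤ 1#
  reciprocal≤ {i} 2≤i = ≤-trans (*-monoʳ-≤ (/-nonNeg 0≤1 0<i) (fromℕ-mono-≤ 2≤i)) (≤-reflexive (*-/-cancel 0<i))
    where 0<i = fromℕ-pos (ℕ.≤-trans (ℕ.s≤s ℕ.z≤n) 2≤i)

  reciprocal-nonNeg : ∀ {i} → 2 ℕ.≤ i → 0# ≤ 1# / fromℕ i
  reciprocal-nonNeg 2≤i = /-nonNeg 0≤1 (fromℕ-pos (ℕ.≤-trans (ℕ.s≤s ℕ.z≤n) 2≤i))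

  C-nonNeg : ∀ {i j} → 2 ℕ.≤ i → 2 ℕ.≤ j → 0# ≤ C i j
  C-nonNeg 2≤i 2≤j = *-nonNeg 0≤log2 (+-nonNeg (reciprocal-nonNeg 2≤i) (reciprocal-nonNeg 2≤j))

  C≤1 : ∀ {i j} → 2 ℕ.≤ i → 2 ℕ.≤ j → C i j ≤ 1#
  C≤1 {i} {j} 2≤i 2≤j = ≤-trans (*-mono-≤ 0≤log2 (+-nonNeg (reciprocal-nonNeg 2≤i) (reciprocal-nonNeg 2≤j)) log2≤1 sum≤1)
    (≤-reflexive (*-identityˡ 1#))
    where
    sum≤1 : 1# / fromℕ i + 1# / fromℕ j ≤ 1#
    sum≤1 = *-cancelˡ-≤ 0<2 (≤-by (+-nonNeg (x≤y⇒y-x≥0 (reciprocal≤ 2≤i)) (x≤y⇒y-x≥0 (reciprocal≤ 2≤j)))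
      (solve 2 (λ a b → con (+ 1) :- con (+ 2) :* a :+ (con (+ 1) :- con (+ 2) :* b)
                         := con (+ 2) :* con (+ 1) :- con (+ 2) :* (a :+ b)) refl (1# / fromℕ i) (1# / fromℕ j)))

  -- Here L, t, ρ stand for log x, log log x and their quotient, and exp v for
  -- the size of the least possible root of a power dividing a surviving n.
  module Exponents {ε D δ t L ρ c : ℝ}
    (0<ε : 0# < ε) (0<D : 0# < D) (0≤δ : 0# ≤ δ) (δ-def : (1# + fromℕ 2 * ε) * δ ≈ ε)
    (1+2ε≤t : 1# + fromℕ 2 * ε ≤ t) (16≤εt : fromℕ 16 ≤ ε * t) (4D≤εδδt : fromℕ 4 * D ≤ ε * (δ * δ) * t)
    (exp-t : exp t ≈ L) (tρ≈L : t * ρ ≈ L) (0≤c : 0# ≤ c) (c≤1 : c ≤ 1#)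
    where

    0≤ε = <⇒≤ 0<ε

    1≤t : 1# ≤ t
    1≤t = ≤-trans (≤-by (+-nonNeg 0≤ε 0≤ε) (solve 1 (λ ε → ε :+ ε := con (+ 1) :+ con (+ 2) :* ε :- con (+ 1)) refl ε)) 1+2ε≤t

    0<t : 0# < t
    0<t = <-≤-trans 0<1 1≤t

    0≤t = <⇒≤ 0<t

    t²≤4L : t * t ≤ fromℕ 4 * L
    t²≤4L = ≤-trans (x²≤4exp 0≤t) (≤-reflexive (*-congˡ exp-t))

    t≤4ρ : t ≤ fromℕ 4 * ρ
    t≤4ρ = *-cancelˡ-≤ 0<t (≤-trans t²≤4L (≤-reflexive (trans (*-congˡ (sym tρ≈L))
      (solve 2 (λ t ρ → con (+ 4) :* (t :* ρ) := t :* (con (+ 4) :* ρ)) refl t ρ))))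

    -- The origin of the threshold 16: `t ≤ 4ρ` costs a factor 4, and the remaining 4 is what
    -- `4t≤εL` and `8≤u` call for.
    4≤ερ : fromℕ 4 ≤ ε * ρ
    4≤ερ = *-cancelˡ-≤ (fromℕ-pos {4} (ℕ.s≤s ℕ.z≤n)) (≤-by
      (+-nonNeg (x≤y⇒y-x≥0 16≤εt) (*-nonNeg 0≤ε (x≤y⇒y-x≥0 t≤4ρ)))
      (solve 3 (λ ε t ρ → ε :* t :- con (+ 16) :+ ε :* (con (+ 4) :* ρ :- t) := con (+ 4) :* (ε :* ρ) :- con (+ 4) :* con (+ 4)) refl ε t ρ))

    4t≤εL : fromℕ 4 * t ≤ ε * L
    4t≤εL = ≤-by (*-nonNeg 0≤t (x≤y⇒y-x≥0 4≤ερ)) (trans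
      (solve 3 (λ ε t ρ → t :* (ε :* ρ :- con (+ 4)) := ε :* (t :* ρ) :- con (+ 4) :* t) refl ε t ρ) (+-congʳ (*-congˡ tρ≈L)))

    0≤ρ : 0# ≤ ρ
    0≤ρ = *-cancelˡ-≤ (fromℕ-pos {4} (ℕ.s≤s ℕ.z≤n)) (≤-trans (≤-reflexive (zeroʳ _)) (≤-trans 0≤t t≤4ρ))

    u : ℝ
    u = (c + fromℕ 2 * ε) * ρ

    -- With `exp u` the length `h` of the interval, `exp v` is at most h/8.
    v : ℝ
    v = u - fromℕ 3

    u≤L : u ≤ L
    u≤L = ≤-trans (*-monoʳ-≤ 0≤ρ (≤-trans (+-mono-≤ c≤1 ≤-refl) 1+2ε≤t)) (≤-reflexive tρ≈L)

    8≤u : fromℕ 8 ≤ u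
    8≤u = ≤-by (+-nonNeg (*-nonNeg 0≤c 0≤ρ) (+-nonNeg 0≤ερ-4 0≤ερ-4))
      (solve 3 (λ c ε ρ → c :* ρ :+ (ε :* ρ :- con (+ 4) :+ (ε :* ρ :- con (+ 4))) := (c :+ con (+ 2) :* ε) :* ρ :- con (+ 8)) refl c ε ρ)
      where 0≤ερ-4 = x≤y⇒y-x≥0 4≤ερ

    0<v : 0# < v
    0<v = <-≤-trans (fromℕ-pos {5} (ℕ.s≤s ℕ.z≤n)) (≤-by (x≤y⇒y-x≥0 8≤u)
      (solve 1 (λ u → u :- con (+ 8) := u :- con (+ 3) :- con (+ 5)) refl u))

    0≤L : 0# ≤ L
    0≤L = ≤-trans (exp-nonNeg t) (≤-reflexive exp-t)

    -- Multiplying out, `v * t` is (c + 2ε) L - 3t. The factor 1 - δ takes away at most εL, since δ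
    -- (c + 2ε) ≤ δ (1 + 2ε) = ε. The other εL is at least 4t, which covers 3t and `c ≤ 1 ≤ t`. The
    -- summands of the certificate are these slacks.
    c[1+L]≤v[1-δ]t : c * (1# + L) ≤ v * ((1# - δ) * t)
    c[1+L]≤v[1-δ]t = ≤-by
      (+-nonNeg (x≤y⇒y-x≥0 4t≤εL) (+-nonNeg (x≤y⇒y-x≥0 1≤t) (+-nonNeg 0≤1-c (+-nonNeg (*-nonNeg (*-nonNeg 0≤δ 0≤1-c) 0≤L)
        (+-nonNeg (*-nonNeg (*-nonNeg (fromℕ-nonNeg 3) 0≤δ) 0≤t) (*-nonNeg (x≤y⇒y-x≥0 (≤-reflexive δ-def)) 0≤L))))))
      (trans (+-cong (+-congʳ (*-congˡ (sym tρ≈L))) (+-congˡ (+-congˡ (+-cong (*-congˡ (sym tρ≈L)) (+-congˡ (*-congˡ (sym tρ≈L)))))))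
        (trans (identity ε δ t ρ c) (+-congˡ (-‿cong (*-congˡ (+-congˡ tρ≈L))))))
      where
      0≤1-c = x≤y⇒y-x≥0 c≤1
      identity : ∀ ε δ t ρ c →
        (ε * (t * ρ) - fromℕ 4 * t) + ((t - 1#) + ((1# - c) + (δ * (1# - c) * (t * ρ)
          + (fromℕ 3 * δ * t + (ε - (1# + fromℕ 2 * ε) * δ) * (t * ρ)))))
        ≈ ((c + fromℕ 2 * ε) * ρ - fromℕ 3) * ((1# - δ) * t) - c * (1# + t * ρ)
      identity = solve 5 (λ ε δ t ρ c →
        (ε :* (t :* ρ) :- con (+ 4) :* t) :+ ((t :- con (+ 1)) :+ ((con (+ 1) :- c) :+ (δ :* (con (+ 1) :- c) :* (t :* ρ)
          :+ (con (+ 3) :* δ :* t :+ (ε :- (con (+ 1) :+ con (+ 2) :* ε) :* δ) :* (t :* ρ)))))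
        := ((c :+ con (+ 2) :* ε) :* ρ :- con (+ 3)) :* ((con (+ 1) :- δ) :* t) :- c :* (con (+ 1) :+ t :* ρ)) refl

    -- By (δt)² ≤ 4 exp (δt), a bound linear in `t` suffices, namely the hypothesis `4D≤εδδt`.
    Dt≤εexp[δt] : D * t ≤ ε * exp (δ * t)
    Dt≤εexp[δt] = *-cancelˡ-≤ (fromℕ-pos {4} (ℕ.s≤s ℕ.z≤n)) (≤-by
      (+-nonNeg (*-nonNeg (x≤y⇒y-x≥0 4D≤εδδt) 0≤t) (*-nonNeg 0≤ε (x≤y⇒y-x≥0 (x²≤4exp (*-nonNeg 0≤δ 0≤t)))))
      (solve 5 (λ ε D δ t e → (ε :* (δ :* δ) :* t :- con (+ 4) :* D) :* t :+ ε :* (con (+ 4) :* e :- δ :* t :* (δ :* t))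
                  := con (+ 4) :* (ε :* e) :- con (+ 4) :* (D :* t)) refl ε D δ t (exp (δ * t))))

    -- Since K ≤ (1 - δ) t, `d` is at most L exp (-δt), and exp (δt) outweighs the factor Dt/ε.
    penalty-bound : ∀ {K d} → v * K ≤ c * (1# + L) → d ≤ exp K → D * d ≤ ε * ρ
    penalty-bound {K} {d} vK≤ d≤expK = *-cancelˡ-≤ 0<t (begin
      t * (D * d)                                ≤⟨ *-monoˡ-≤ 0≤t (*-monoˡ-≤ (<⇒≤ 0<D) (≤-trans d≤expK (exp-mono-≤ K≤))) ⟩
      t * (D * exp ((1# - δ) * t))               ≈⟨ solve 3 (λ t D e → t :* (D :* e) := D :* t :* e) refl t D (exp ((1# - δ) * t)) ⟩
      D * t * exp ((1# - δ) * t)                 ≤⟨ *-monoʳ-≤ (exp-nonNeg _) Dt≤εexp[δt] ⟩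
      ε * exp (δ * t) * exp ((1# - δ) * t)       ≈⟨ *-assoc ε _ _ ⟩
      ε * (exp (δ * t) * exp ((1# - δ) * t))     ≈⟨ *-congˡ (exp-+ (δ * t) ((1# - δ) * t)) ⟨
      ε * exp (δ * t + (1# - δ) * t)             ≈⟨ *-congˡ (exp-cong (solve 2 (λ δ t → δ :* t :+ (con (+ 1) :- δ) :* t := t) refl δ t)) ⟩
      ε * exp t                                  ≈⟨ *-congˡ (trans exp-t (sym tρ≈L)) ⟩
      ε * (t * ρ)                                ≈⟨ solve 3 (λ ε t ρ → ε :* (t :* ρ) := t :* (ε :* ρ)) refl ε t ρ ⟩
      t * (ε * ρ)                                ∎)
      where
      K≤ : K ≤ (1# - δ) * t
      K≤ = *-cancelˡ-≤ 0<v (≤-trans vK≤ c[1+L]≤v[1-δ]t)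

  -- From the sieve to the sum

  root-exponent-bound : ∀ {w i k n v B} → 0 ℕ.< i → exp v ≤ fromℕ w → w ℕ.^ (i ℕ.* k) ℕ.≤ n → fromℕ n ≤ exp B →
    v * fromℕ k ≤ 1# / fromℕ i * B
  root-exponent-bound {w} {i} {k} {n} {v} {B} 0<i expv≤w w^ik≤n n≤expB = *-cancelˡ-≤ (fromℕ-pos 0<i) (begin
    fromℕ i * (v * fromℕ k)             ≈⟨ solve 3 (λ i v k → i :* (v :* k) := i :* k :* v) refl (fromℕ i) v (fromℕ k) ⟩
    fromℕ i * fromℕ k * v               ≈⟨ *-congʳ (fromℕ-* i k) ⟨
    fromℕ (i ℕ.* k) * v                 ≤⟨ exp-cancel-≤ power≤ ⟩
    B                                   ≈⟨ *-identityˡ B ⟨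
    1# * B                              ≈⟨ *-congʳ (*-/-cancel (fromℕ-pos 0<i)) ⟨
    fromℕ i * (1# / fromℕ i) * B        ≈⟨ *-assoc (fromℕ i) (1# / fromℕ i) B ⟩
    fromℕ i * (1# / fromℕ i * B)        ∎)
    where
    power≤ : exp (fromℕ (i ℕ.* k) * v) ≤ exp B
    power≤ = begin
      exp (fromℕ (i ℕ.* k) * v)    ≈⟨ exp-fromℕ-* (i ℕ.* k) v ⟩
      exp v ^ (i ℕ.* k)            ≤⟨ ^-mono-≤ (i ℕ.* k) (exp-nonNeg v) expv≤w ⟩
      fromℕ w ^ (i ℕ.* k)          ≈⟨ fromℕ-^ w (i ℕ.* k) ⟨
      fromℕ (w ℕ.^ (i ℕ.* k))      ≤⟨ fromℕ-mono-≤ w^ik≤n ⟩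
      fromℕ n                      ≤⟨ n≤expB ⟩
      exp B                        ∎

  -- Each stripped prime power contributes log 2 to `K`. With `k` and `l` strips for `i` and `j`,
  -- `v * k ≤ B / i` and `v * l ≤ B / j` add up to the constant `C i j`.
  d-exponent-bound : ∀ {i j m n v B} → 2 ℕ.≤ i → 2 ℕ.≤ j → 0 ℕ.< n → Avoids m n →
    exp v ≤ fromℕ (2 ℕ.+ m) → fromℕ n ≤ exp B →
    ∃ λ K → v * K ≤ C i j * B × fromℕ (d i j n) ≤ exp K
  d-exponent-bound {i} {j} {m} {n} {v} {B} 2≤i 2≤j 0<n avoids expv≤w n≤expB =
    combine (divisors i 2≤i) (divisors j 2≤j)
    where
    w = 2 ℕ.+ m

    Divisors : ℕ → Set
    Divisors i = ∃ λ k → w ℕ.^ (i ℕ.* k) ℕ.≤ n × ∃ λ as → length as ℕ.≤ 2 ℕ.^ k × (∀ a → a ℕ.^ i ∣ n → a ∈ as)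

    positive : ∀ {i} → 2 ℕ.≤ i → 0 ℕ.< i
    positive 2≤i = ℕ.≤-trans (ℕ.s≤s ℕ.z≤n) 2≤i

    divisors : ∀ i → 2 ℕ.≤ i → Divisors i
    divisors i 2≤i = power-divisors w i {{ℕ.>-nonZero (positive 2≤i)}} n {{ℕ.>-nonZero 0<n}} (λ a → avoids-root a 2≤i avoids)

    combine : Divisors i → Divisors j → ∃ λ K → v * K ≤ C i j * B × fromℕ (d i j n) ≤ exp K
    combine (k , w^ik≤n , as , as≤ , as-complete) (l , w^jl≤n , bs , bs≤ , bs-complete) =
      fromℕ (k ℕ.+ l) * ℓ , exponent , count≤
      where
      ℓ = log (fromℕ 2)

      exponent : v * (fromℕ (k ℕ.+ l) * ℓ) ≤ ℓ * (1# / fromℕ i + 1# / fromℕ j) * B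
      exponent = begin
        v * (fromℕ (k ℕ.+ l) * ℓ)                         ≈⟨ *-congˡ (*-congʳ (fromℕ-+ k l)) ⟩
        v * ((fromℕ k + fromℕ l) * ℓ)
          ≈⟨ solve 4 (λ v k l ℓ → v :* ((k :+ l) :* ℓ) := ℓ :* (v :* k :+ v :* l)) refl v (fromℕ k) (fromℕ l) ℓ ⟩
        ℓ * (v * fromℕ k + v * fromℕ l)                   ≤⟨ *-monoˡ-≤ 0≤log2 (+-mono-≤
          (root-exponent-bound {w} {i} {k} (positive 2≤i) expv≤w w^ik≤n n≤expB)
          (root-exponent-bound {w} {j} {l} (positive 2≤j) expv≤w w^jl≤n n≤expB)) ⟩
        ℓ * (1# / fromℕ i * B + 1# / fromℕ j * B)
          ≈⟨ solve 4 (λ ℓ a b B → ℓ :* (a :* B :+ b :* B) := ℓ :* (a :+ b) :* B) refl ℓ (1# / fromℕ i) (1# / fromℕ j) B ⟩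
        ℓ * (1# / fromℕ i + 1# / fromℕ j) * B             ∎

      d≤2^k+l : d i j n ℕ.≤ 2 ℕ.^ (k ℕ.+ l)
      d≤2^k+l = ℕ.≤-trans (d-bound i j n as-complete bs-complete)
        (ℕ.≤-trans (ℕ.*-mono-≤ as≤ bs≤) (ℕ.≤-reflexive (≡.sym (ℕ.^-distribˡ-+-* 2 k l))))

      count≤ : fromℕ (d i j n) ≤ exp (fromℕ (k ℕ.+ l) * ℓ)
      count≤ = ≤-trans (fromℕ-mono-≤ d≤2^k+l) (≤-reflexive (fromℕ-2^ (k ℕ.+ l)))

  record Survivors (x y : ℝ) : Set where
    field
      X H m       : ℕ
      floor≡      : floor (x + y) ≡ X ℕ.+ H
      inside      : ∀ {n} → X ℕ.< n → n ℕ.≤ X ℕ.+ H → x < fromℕ n × fromℕ n ≤ x + y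
      y≤8w        : y ≤ fromℕ 8 * fromℕ (2 ℕ.+ m)
      y≤16count   : y ≤ fromℕ 16 * fromℕ (count (above∧avoids? X m) (suc (X ℕ.+ H)))

  survivors : ∀ {x y} → 0# ≤ x → fromℕ 9 ≤ y → Survivors x y
  survivors {x} {y} 0≤x 9≤y = build (many-avoid X H (ℕ.≤-trans (ℕ.n≤1+n 8) 9≤H))
    where
    0≤x+y : 0# ≤ x + y
    0≤x+y = +-nonNeg 0≤x (≤-trans (fromℕ-nonNeg 9) 9≤y)

    X = floor x
    Z = floor (x + y)
    H = Z ℕ.∸ X

    x-floor : fromℕ X ≤ x × x < fromℕ (suc X)
    x-floor = floor-spec 0≤x

    z-floor : fromℕ Z ≤ x + y × x + y < fromℕ (suc Z)
    z-floor = floor-spec 0≤x+y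

    X≤Z : X ℕ.≤ Z
    X≤Z = fromℕ-cancel-≤ (≤-<-trans (≤-trans (proj₁ x-floor)
      (≤-by (≤-trans (fromℕ-nonNeg 9) 9≤y) (solve 2 (λ x y → y := x :+ y :- x) refl x y))) (proj₂ z-floor))

    Z≡X+H : Z ≡ X ℕ.+ H
    Z≡X+H = ≡.sym (ℕ.m+[n∸m]≡n X≤Z)

    y<1+H : y < fromℕ (suc H)
    y<1+H = <-by (+-pos-nonNeg (x<y⇒y-x>0 (<-≤-trans (proj₂ z-floor) (≤-reflexive 1+Z))) (x≤y⇒y-x≥0 (proj₁ x-floor)))
      (solve 4 (λ x y X H → con (+ 1) :+ (X :+ H) :- (x :+ y) :+ (x :- X) := con (+ 1) :+ H :- y) refl x y (fromℕ X) (fromℕ H))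
      where
      1+Z : fromℕ (suc Z) ≈ 1# + (fromℕ X + fromℕ H)
      1+Z = +-congˡ (trans (reflexive (≡.cong fromℕ Z≡X+H)) (fromℕ-+ X H))

    9≤H : 9 ℕ.≤ H
    9≤H = fromℕ-cancel-≤ (≤-<-trans 9≤y y<1+H)

    build : (∃ λ m → H ℕ.< 8 ℕ.* (2 ℕ.+ m) × H ℕ.≤ 8 ℕ.* count (above∧avoids? X m) (suc (X ℕ.+ H))) → Survivors x y
    build (m , H<8w , H≤8G) = record
      { X = X ; H = H ; m = m ; floor≡ = Z≡X+H
      ; inside = λ X<n n≤X+H → <-≤-trans (proj₂ x-floor) (fromℕ-mono-≤ X<n) ,
          ≤-trans (fromℕ-mono-≤ (ℕ.≤-trans n≤X+H (ℕ.≤-reflexive (≡.sym Z≡X+H)))) (proj₁ z-floor)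
      -- The strict `H < 8 * (2 + m)` makes up for the fraction by which `y` may exceed `H`.
      ; y≤8w = ≤-trans (<⇒≤ y<1+H) (≤-trans (fromℕ-mono-≤ H<8w) (≤-reflexive (fromℕ-* 8 (2 ℕ.+ m))))
      ; y≤16count = ≤-trans (<⇒≤ y<1+H) (≤-trans (fromℕ-mono-≤ 1+H≤16G) (≤-reflexive (fromℕ-* 16 G)))
      }
      where
      G = count (above∧avoids? X m) (suc (X ℕ.+ H))
      -- Rounding is paid for by `1 + H ≤ H + H`, which doubles 8 to 16; this is where `E` = 1/16
      -- comes from.
      1+H≤16G : suc H ℕ.≤ 16 ℕ.* G
      1+H≤16G = ℕ.≤-trans (ℕ.+-monoˡ-≤ H (ℕ.≤-trans (ℕ.s≤s ℕ.z≤n) 9≤H))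
        (ℕ.≤-trans (ℕ.+-mono-≤ H≤8G H≤8G) (ℕ.≤-reflexive (≡.sym (ℕ.*-distribʳ-+ G 8 8))))

  sum-bound : ∀ {x y v B i j} {D P : ℝ} → 0# ≤ x → fromℕ 9 ≤ y → 2 ℕ.≤ i → 2 ℕ.≤ j →
    fromℕ 8 * exp v ≤ y → x + y ≤ exp B →
    (∀ {K d} → v * K ≤ C i j * B → d ≤ exp K → D * d ≤ P) →
    y * exp (- P) ≤ fromℕ 16 * ∑ integersIn⦅ x , x + y ] (λ n → exp (- (D * fromℕ (d i j n))))
  sum-bound {x} {y} {v} {B} {i} {j} {D} {P} 0≤x 9≤y 2≤i 2≤j 8expv≤y x+y≤expB penalty = begin
    y * exp (- P)                                                  ≤⟨ *-monoʳ-≤ (exp-nonNeg _) y≤16count ⟩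
    fromℕ 16 * fromℕ (count (above∧avoids? X m) (suc (X ℕ.+ H))) * exp (- P)
                                                                   ≈⟨ *-assoc (fromℕ 16) _ _ ⟩
    fromℕ 16 * (fromℕ (count (above∧avoids? X m) (suc (X ℕ.+ H))) * exp (- P))
                                                                   ≈⟨ *-congˡ (*-congʳ (reflexive (≡.cong (λ Z → fromℕ (count (above∧avoids? X m) (suc Z))) floor≡))) ⟨
    fromℕ 16 * (fromℕ (count (above∧avoids? X m) (suc (floor (x + y)))) * exp (- P))
                                                                   ≤⟨ *-monoˡ-≤ (fromℕ-nonNeg 16) (∑-filter-≥
      (λ n → em {x < fromℕ n} ×-dec em {fromℕ n ≤ x + y}) (above∧avoids? X m) (λ _ → exp-nonNeg _) (upTo (suc (floor (x + y)))) survives) ⟩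
    fromℕ 16 * ∑ integersIn⦅ x , x + y ] (λ n → exp (- (D * fromℕ (d i j n)))) ∎
    where
    open Survivors (survivors 0≤x 9≤y)

    expv≤w : exp v ≤ fromℕ (2 ℕ.+ m)
    expv≤w = *-cancelˡ-≤ (fromℕ-pos {8} (ℕ.s≤s ℕ.z≤n)) (≤-trans 8expv≤y y≤8w)

    survives : ∀ {n} → n ∈ upTo (suc (floor (x + y))) → X ℕ.< n × Avoids m n →
      (x < fromℕ n × fromℕ n ≤ x + y) × exp (- P) ≤ exp (- (D * fromℕ (d i j n)))
    survives {n} n∈ (X<n , avoids) = n-inside , exp-mono-≤ (neg-anti-≤ (bounded
      (d-exponent-bound 2≤i 2≤j (ℕ.≤-trans (ℕ.s≤s ℕ.z≤n) X<n) avoids expv≤w (≤-trans (proj₂ n-inside) x+y≤expB))))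
      where
      n-inside : x < fromℕ n × fromℕ n ≤ x + y
      n-inside = inside X<n (ℕ.≤-trans (ℕ.s≤s⁻¹ (∈-upTo⁻ n∈)) (ℕ.≤-reflexive floor≡))

      bounded : (∃ λ K → v * K ≤ C i j * B × fromℕ (d i j n) ≤ exp K) → D * fromℕ (d i j n) ≤ P
      bounded (K , vK≤ , d≤expK) = penalty vK≤ d≤expK

  -- Thresholds and conclusion

  module _ (ε D : ℝ) (0<ε : 0# < ε) (0<D : 0# < D) where

    private
      -- With `c = 1` the saved exponent is 1 - 1/(1 + 2ε) = 2δ, and `δ` is half of it. `T` adds up
      -- the three lower bounds required of log log x, a sum doing duty for a maximum; it involves
      -- `ε` and `D` only.
      b δ T : ℝ
      b = 1# + fromℕ 2 * ε
      δ = ε / b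
      T = b + (fromℕ 16 / ε + fromℕ 4 * D / (ε * (δ * δ)))

      0<b : 0# < b
      0<b = +-pos-nonNeg 0<1 (*-nonNeg (<⇒≤ 0<2) (<⇒≤ 0<ε))

      0<δ : 0# < δ
      0<δ = /-pos 0<ε 0<b

      0<εδδ : 0# < ε * (δ * δ)
      0<εδδ = *-pos 0<ε (*-pos 0<δ 0<δ)

      0≤16/ε : 0# ≤ fromℕ 16 / ε
      0≤16/ε = /-nonNeg (fromℕ-nonNeg 16) 0<ε

      0≤4D/εδδ : 0# ≤ fromℕ 4 * D / (ε * (δ * δ))
      0≤4D/εδδ = /-nonNeg (*-nonNeg (fromℕ-nonNeg 4) (<⇒≤ 0<D)) 0<εδδ

      0≤T : 0# ≤ T
      0≤T = +-nonNeg (<⇒≤ 0<b) (+-nonNeg 0≤16/ε 0≤4D/εδδ)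

      0<16 : 0# < fromℕ 16
      0<16 = fromℕ-pos {16} (ℕ.s≤s ℕ.z≤n)

    lower-bound : ∀ i j → 2 ℕ.≤ i → 2 ℕ.≤ j → ∀ x → exp (exp T) < x →
      1# / fromℕ 16 * exp ((C i j + ε) * (log x / log (log x)))
        ≤ ∑ integersIn⦅ x , x + h ε i j x ] (λ n → exp (- (D * fromℕ (d i j n))))
    lower-bound i j 2≤i 2≤j x N<x = *-cancelˡ-≤ 0<16 (begin
      fromℕ 16 * (1# / fromℕ 16 * exp ((C i j + ε) * ρ))     ≈⟨ *-assoc _ _ _ ⟨
      fromℕ 16 * (1# / fromℕ 16) * exp ((C i j + ε) * ρ)     ≈⟨ *-congʳ (*-/-cancel 0<16) ⟩
      1# * exp ((C i j + ε) * ρ)                             ≈⟨ *-identityˡ _ ⟩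
      exp ((C i j + ε) * ρ)                                  ≈⟨ exp-cong (solve 3 (λ c ε ρ →
        (c :+ ε) :* ρ := (c :+ con (+ 2) :* ε) :* ρ :+ (:- (ε :* ρ))) refl (C i j) ε ρ) ⟩
      exp (u + - (ε * ρ))                                    ≈⟨ exp-+ u (- (ε * ρ)) ⟩
      exp u * exp (- (ε * ρ))                                ≤⟨ sum-bound 0≤x 9≤expu 2≤i 2≤j 8expv≤expu x+expu≤exp[1+L] penalty-bound ⟩
      fromℕ 16 * ∑ integersIn⦅ x , x + exp u ] (λ n → exp (- (D * fromℕ (d i j n)))) ∎)
      where
      L = log x
      t = log L
      ρ = L / t

      expT<L : exp T < L
      expT<L = exp<⇒<log (exp-nonNeg T) N<x

      T<t : T < t
      T<t = exp<⇒<log 0≤T expT<L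

      1≤x : 1# ≤ x
      1≤x = ≤-trans (1≤exp (exp-nonNeg T)) (<⇒≤ N<x)

      0≤x : 0# ≤ x
      0≤x = ≤-trans 0≤1 1≤x

      b≤t : b ≤ t
      b≤t = ≤-trans (≤-by (+-nonNeg 0≤16/ε 0≤4D/εδδ) (solve 2 (λ b z → z := b :+ z :- b) refl b _)) (<⇒≤ T<t)

      16/ε≤t : fromℕ 16 / ε ≤ t
      16/ε≤t = ≤-trans (≤-by (+-nonNeg (<⇒≤ 0<b) 0≤4D/εδδ)
        (solve 3 (λ b y z → b :+ z := b :+ (y :+ z) :- y) refl b (fromℕ 16 / ε) (fromℕ 4 * D / (ε * (δ * δ))))) (<⇒≤ T<t)

      4D/εδδ≤t : fromℕ 4 * D / (ε * (δ * δ)) ≤ t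
      4D/εδδ≤t = ≤-trans (≤-by (+-nonNeg (<⇒≤ 0<b) 0≤16/ε)
        (solve 3 (λ b y z → b :+ y := b :+ (y :+ z) :- z) refl b (fromℕ 16 / ε) (fromℕ 4 * D / (ε * (δ * δ))))) (<⇒≤ T<t)

      open Exponents {t = t} {L} {ρ} {C i j} 0<ε 0<D (<⇒≤ 0<δ) (*-/-cancel 0<b) b≤t
        (/-≤⇒≤-* 0<ε 16/ε≤t) (/-≤⇒≤-* 0<εδδ 4D/εδδ≤t)
        (exp-log (≤-trans (1≤exp 0≤T) (<⇒≤ expT<L))) (*-/-cancel (<-≤-trans 0<b b≤t))
        (C-nonNeg 2≤i 2≤j) (C≤1 2≤i 2≤j)

      9≤expu : fromℕ 9 ≤ exp u
      9≤expu = ≤-trans (+-mono-≤ ≤-refl 8≤u) (1+x≤exp (≤-trans (fromℕ-nonNeg 8) 8≤u))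

      8expv≤expu : fromℕ 8 * exp v ≤ exp u
      8expv≤expu = ≤-trans (8exp≤exp+3 v) (≤-reflexive (exp-cong (solve 1 (λ u → u :- con (+ 3) :+ con (+ 3) := u) refl u)))

      -- As `u ≤ L` gives h ≤ x, every n in the interval is at most 2x ≤ exp 1 · x; hence `1# + L`
      -- as the bound for log n.
      x+expu≤exp[1+L] : x + exp u ≤ exp (1# + L)
      x+expu≤exp[1+L] = begin
        x + exp u              ≤⟨ +-mono-≤ (≤-reflexive (sym (exp-log 1≤x))) (exp-mono-≤ u≤L) ⟩
        exp L + exp L          ≈⟨ solve 1 (λ y → y :+ y := con (+ 2) :* y) refl (exp L) ⟩
        fromℕ 2 * exp L        ≤⟨ *-monoʳ-≤ (exp-nonNeg L) 2≤exp1 ⟩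
        exp 1# * exp L         ≈⟨ exp-+ 1# L ⟨
        exp (1# + L)           ∎

    short-interval-bound : ∃ λ (E : ℝ) → ∃ λ (N : ℝ) → 0# < E × 0# < N ×
      ((i j : ℕ) → 2 ℕ.≤ i → 2 ℕ.≤ j → (x : ℝ) → N < x →
        E * exp ((C i j + ε) * (log x / log (log x)))
          ≤ ∑ integersIn⦅ x , x + h ε i j x ] (λ n → exp (- (D * fromℕ (d i j n)))))
    short-interval-bound = 1# / fromℕ 16 , exp (exp T) , /-pos 0<1 0<16 , exp-pos (exp T) , lower-bound

lemma5 : (em : ExcludedMiddle 0ℓ) (R : CompleteOrderedField) →
    let open Analysis em R in
    (ε D : ℝ) → 0# < ε → 0# < D →
    ∃ λ (E : ℝ) → ∃ λ (N : ℝ) → 0# < E × 0# < N ×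
    ((i j : ℕ) → 2 ℕ.≤ i → 2 ℕ.≤ j → (x : ℝ) → N < x →
    E * exp ((C i j + ε) * (log x / log (log x)))
    ≤ ∑ integersIn⦅ x , x + h ε i j x ] (λ n → exp (- (D * fromℕ (d i j n)))))
lemma5 = Reals.short-interval-bound
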